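{- Let $t$ be a nonnegative integer, and let $G$ be a sparse-dense graph with respect to classes $\mathcal S$ (sparse) and $\mathcal D$ (dense), such that $\mathcal D$ is a subclass of the class of $\overline{K_t}$-free graphs, and $\mathcal S$ is a graph class that is recognizable in $T_1(n)$ time on $n$-vertex graphs and for whose $n$-vertex members a maximum independent set can be found in $T_2(n)$ time. Then a maximum independent set of $G$ can be found in $(T_1(n)+T_2(n))\cdot n^{\mathcal{O}(t)}$ time, where $n=|V(G)|$.
   Context: Graphs are finite, simple and undirected. Classes $\mathcal S$ and $\mathcal D$ of graphs are called classes of sparse and dense graphs, respectively, if both are closed under taking induced subgraphs and there is a constant $c$ (depending only on the two fixed classes) such that $|S\cap D|\le c$ for any $S\in\mathcal S$ and $D\in\mathcal D$ (here $S$, $D$ are identified with vertex subsets, of a common graph, inducing graphs in the respective class). A sparse-dense partition of a graph $G$ with respect to $\mathcal S$ and $\mathcal D$ is a partition $V(G)=S\cup D$ into two disjoint parts such that $S\in\mathcal S$ and $D\in\mathcal D$ (i.e., the induced subgraphs $G[S]$, $G[D]$ belong to $\mathcal S$, $\mathcal D$). A graph admitting such a partition is called a sparse-dense graph with respect to $\mathcal S$ and $\mathcal D$. A graph is $\overline{K_t}$-free if it has no independent set of size $t$ (equivalently, its complement is $K_t$-free). A maximum independent set is an independent set of largest cardinality. The input of the algorithm is the graph $G$; no sparse-dense partition is given.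
   Formalization: The time bounds T_1 and T_2 are assumed non-decreasing; without this the claim fails (unless P = NP), because the algorithm must run the given procedures on induced subgraphs with fewer than n vertices. -}

module Defs where

open import Data.Bool using (Bool; true; false; if_then_else_; not)
open import Data.Fin using (Fin; zero; suc; toℕ)
open import Data.Fin.Subset using (Subset; inside; outside; ⊤; ⊥; _∈_; _∩_; _∪_; ∣_∣)
open import Data.Nat using (ℕ; suc; _+_; _*_; _∸_; _≤_; _≡ᵇ_)
open import Data.Product using (∃₂; _×_)
open import Data.Sum using (_⊎_)
open import Data.Vec using (_∷_; tabulate)
open import Function.Bundles using (_↔_; Inverse)
open import Level using (Level; _⊔_) renaming (suc to lsuc)
open import Relation.Binary.PropositionalEquality using (_≡_; _≢_)
open import Relation.Nullary using (¬_)
open import Relation.Unary using (Pred)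

private
  variable
    ℓ ℓ₁ ℓ₂ : Level

record Graph : Set where
  field
    order  : ℕ
    adj    : Fin order → Fin order → Bool
    irrefl : ∀ u → adj u u ≡ false
    symm   : ∀ u v → adj u v ≡ adj v u

open Graph public

VertexSet : Graph → Set
VertexSet G = Subset (order G)

enum : ∀ {n} (U : Subset n) → Fin ∣ U ∣ → Fin n
enum (inside  ∷ U) zero    = zero
enum (inside  ∷ U) (suc i) = suc (enum U i)
enum (outside ∷ U) i       = suc (enum U i)

infix 8 _[_]

_[_] : (G : Graph) → VertexSet G → Graph
G [ U ] = record
  { order  = ∣ U ∣
  ; adj    = λ i j → adj G (enum U i) (enum U j)
  ; irrefl = λ i → irrefl G (enum U i)
  ; symm   = λ i j → symm G (enum U i) (enum U j)
  }

record _≅_ (G H : Graph) : Set where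
  field
    bijection : Fin (order G) ↔ Fin (order H)
    preserves : ∀ u v →
      adj H (Inverse.to bijection u) (Inverse.to bijection v) ≡ adj G u v

GraphClass : (ℓ : Level) → Set (lsuc ℓ)
GraphClass ℓ = Pred Graph ℓ

-- `iso` is the usual convention that a class of graphs does not depend on
-- vertex names; it is needed because G [ U ] renames the vertices of U.
record Hereditary (𝒞 : GraphClass ℓ) : Set ℓ where
  field
    iso     : ∀ {G H} → G ≅ H → 𝒞 G → 𝒞 H
    induced : ∀ {G} (U : VertexSet G) → 𝒞 G → 𝒞 (G [ U ])

record SparseDenseClasses (𝒮 : GraphClass ℓ₁) (𝒟 : GraphClass ℓ₂) : Set (ℓ₁ ⊔ ℓ₂) where
  field
    sparse-hereditary : Hereditary 𝒮
    dense-hereditary  : Hereditary 𝒟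
    c                 : ℕ
    bounded           : ∀ (G : Graph) (S D : VertexSet G) →
                        𝒮 (G [ S ]) → 𝒟 (G [ D ]) → ∣ S ∩ D ∣ ≤ c

record SparseDensePartition (𝒮 : GraphClass ℓ₁) (𝒟 : GraphClass ℓ₂) (G : Graph)
                            : Set (ℓ₁ ⊔ ℓ₂) where
  field
    S D      : VertexSet G
    cover    : S ∪ D ≡ ⊤
    disjoint : S ∩ D ≡ ⊥
    sparse   : 𝒮 (G [ S ])
    dense    : 𝒟 (G [ D ])

SparseDense : GraphClass ℓ₁ → GraphClass ℓ₂ → GraphClass (ℓ₁ ⊔ ℓ₂)
SparseDense = SparseDensePartition

Independent : (G : Graph) → VertexSet G → Set
Independent G U = ∀ {u v} → u ∈ U → v ∈ U → adj G u v ≡ false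

MaximumIndependent : (G : Graph) → VertexSet G → Set
MaximumIndependent G U =
  Independent G U × (∀ W → Independent G W → ∣ W ∣ ≤ ∣ U ∣)

CoKFree : ℕ → GraphClass _
CoKFree t G = ∀ (U : VertexSet G) → Independent G U → ∣ U ∣ ≢ t

-- Model of computation: structured programs for the unit-cost
-- random-access machine.  A state consists of integer registers and
-- randomly accessible arrays, both named by natural numbers; a program
-- mentions finitely many of them.  Addition and truncated subtraction are
-- the only arithmetic operations: with unit-cost multiplication the machine
-- would not be polynomially equivalent to Turing machines.

record State : Set where
  field
    reg : ℕ → ℕ
    arr : ℕ → ℕ → ℕ

open State public

infixl 6 _⊕_ _⊖_

data Expr : Set where
  lit     : ℕ → Expr
  var     : ℕ → Expr
  _⊕_ _⊖_ : Expr → Expr → Expr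
  read    : ℕ → Expr → Expr

⟦_⟧ : Expr → State → ℕ
⟦ lit k    ⟧ σ = k
⟦ var x    ⟧ σ = reg σ x
⟦ e ⊕ f    ⟧ σ = ⟦ e ⟧ σ + ⟦ f ⟧ σ
⟦ e ⊖ f    ⟧ σ = ⟦ e ⟧ σ ∸ ⟦ f ⟧ σ
⟦ read a e ⟧ σ = arr σ a (⟦ e ⟧ σ)

cost : Expr → ℕ
cost (lit _)    = 1
cost (var _)    = 1
cost (e ⊕ f)    = 1 + cost e + cost f
cost (e ⊖ f)    = 1 + cost e + cost f
cost (read _ e) = 1 + cost e

infix  5 _≔_ _⟨_⟩≔_
infixr 4 _⨾_

data Program : Set where
  skip    : Program
  _≔_     : ℕ → Expr → Program
  _⟨_⟩≔_  : ℕ → Expr → Expr → Program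
  _⨾_     : Program → Program → Program
  ifnz    : Expr → Program → Program → Program
  whilenz : Expr → Program → Program

setReg : ℕ → ℕ → State → State
setReg x k σ = record σ { reg = λ y → if y ≡ᵇ x then k else reg σ y }

setArr : ℕ → ℕ → ℕ → State → State
setArr a i k σ = record σ
  { arr = λ b j → if b ≡ᵇ a then (if j ≡ᵇ i then k else arr σ b j) else arr σ b j }

-- ⟨ P , σ ⟩⇓⟨ τ , k ⟩ : started in σ, P halts in τ after k steps.
data ⟨_,_⟩⇓⟨_,_⟩ : Program → State → State → ℕ → Set where
  ⇓skip  : ∀ {σ} → ⟨ skip , σ ⟩⇓⟨ σ , 1 ⟩
  ⇓reg   : ∀ {σ x e} →
           ⟨ x ≔ e , σ ⟩⇓⟨ setReg x (⟦ e ⟧ σ) σ , 1 + cost e ⟩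
  ⇓arr   : ∀ {σ a e f} →
           ⟨ a ⟨ e ⟩≔ f , σ ⟩⇓⟨ setArr a (⟦ e ⟧ σ) (⟦ f ⟧ σ) σ , 1 + cost e + cost f ⟩
  ⇓seq   : ∀ {P Q σ τ υ k l} →
           ⟨ P , σ ⟩⇓⟨ τ , k ⟩ → ⟨ Q , τ ⟩⇓⟨ υ , l ⟩ → ⟨ P ⨾ Q , σ ⟩⇓⟨ υ , k + l ⟩
  ⇓then  : ∀ {e P Q σ τ k} → ⟦ e ⟧ σ ≢ 0 →
           ⟨ P , σ ⟩⇓⟨ τ , k ⟩ → ⟨ ifnz e P Q , σ ⟩⇓⟨ τ , 1 + cost e + k ⟩
  ⇓else  : ∀ {e P Q σ τ k} → ⟦ e ⟧ σ ≡ 0 →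
           ⟨ Q , σ ⟩⇓⟨ τ , k ⟩ → ⟨ ifnz e P Q , σ ⟩⇓⟨ τ , 1 + cost e + k ⟩
  ⇓stop  : ∀ {e P σ} → ⟦ e ⟧ σ ≡ 0 →
           ⟨ whilenz e P , σ ⟩⇓⟨ σ , 1 + cost e ⟩
  ⇓again : ∀ {e P σ τ υ k l} → ⟦ e ⟧ σ ≢ 0 →
           ⟨ P , σ ⟩⇓⟨ τ , k ⟩ → ⟨ whilenz e P , τ ⟩⇓⟨ υ , l ⟩ →
           ⟨ whilenz e P , σ ⟩⇓⟨ υ , 1 + cost e + k + l ⟩

-- Register 0 holds the number of vertices and array 0 the row-major
-- adjacency matrix.  The rest of the memory is unspecified: algorithms may
-- not rely on it being cleared.  (Zero-initialised arrays can be simulated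
-- in uninitialised memory with constant-factor overhead.)
record Input (G : Graph) (σ : State) : Set where
  field
    size   : reg σ 0 ≡ order G
    matrix : ∀ u v → arr σ 0 (order G * toℕ u + toℕ v) ≡ (if adj G u v then 1 else 0)

-- The vertex set whose characteristic vector is left in array 0.
outputSet : ∀ n → State → Subset n
outputSet n σ = tabulate (λ v → not (arr σ 0 (toℕ v) ≡ᵇ 0))

HaltsWithin : Program → State → ℕ → (State → Set ℓ) → Set ℓ
HaltsWithin P σ b Post = ∃₂ λ τ k → ⟨ P , σ ⟩⇓⟨ τ , k ⟩ × k ≤ b × Post τ

Recognises : Program → GraphClass ℓ → (ℕ → ℕ) → Set ℓ
Recognises P 𝒞 T = ∀ G σ → Input G σ →
  HaltsWithin P σ (T (order G)) λ τ →
    (reg τ 0 ≡ 1 × 𝒞 G) ⊎ (reg τ 0 ≡ 0 × ¬ 𝒞 G)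

FindsMaximumIndependentSet : Program → GraphClass ℓ → (ℕ → ℕ) → Set ℓ
FindsMaximumIndependentSet P 𝒞 T = ∀ G → 𝒞 G → ∀ σ → Input G σ →
  HaltsWithin P σ (T (order G)) λ τ →
    MaximumIndependent G (outputSet (order G) τ)

{-# OPTIONS --safe #-}

-- Local search: starting from ∅, replace a sparse set B by a larger sparse set
-- that differs from it in at most 2c + 1 vertices, as long as there is one.  If
-- S ∪ D is a sparse-dense partition and |B| < |S|, then dropping B ∖ S (at most c
-- vertices, all in D) and adding |B ∖ S| + 1 vertices of S is such a step, so the
-- search ends with |B| ≥ |S|; neither S nor a recognition algorithm for 𝒟 is
-- needed.  Then |S ∖ B| ≤ |B ∖ S| ≤ c, and an independent set W has fewer than t
-- vertices in D, so it has at most t + c vertices outside B.  Trying every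
-- set X of at most t + c vertices and adding to it a maximum independent set of
-- G[B ∖ N[X]], which is sparse, therefore yields a maximum independent set of G.
module Submission where

open import Defs
open import Data.Bool using (Bool; true; false; if_then_else_; not; _∧_; _∨_) renaming (T to IsTrue)
open import Data.Bool.Properties using
  (∧-conicalˡ; ∧-conicalʳ; ∧-identityʳ; ∧-zeroʳ; ¬-not; not-injective; not-involutive)
open import Data.Fin using (Fin; zero; suc; toℕ; fromℕ<; cast; combine)
import Data.Fin as Fin
open import Data.Fin.Properties using
  (toℕ-fromℕ<; toℕ-injective; toℕ<n; toℕ-combine; combine-injectiveˡ; combine-injectiveʳ;
   cast-involutive)
open import Data.Fin.Subset renaming (_⊆_ to _⊆ˢ_)
open import Data.Fin.Subset.Properties
open import Data.Nat using
  (ℕ; zero; suc; _+_; _*_; _∸_; _^_; _≤_; _<_; _⊔_; z≤n; s≤s; _≡ᵇ_; _≤ᵇ_; _<ᵇ_; NonZero;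
   >-nonZero)
open import Data.Nat.Properties
open import Data.Nat.Tactic.RingSolver using (solve-∀)
open import Data.Product using (∃; ∃-syntax; _×_; _,_; proj₁; proj₂)
import Data.Sum
open import Data.Sum using (_⊎_; inj₁; inj₂)
open import Data.Vec using ([]; _∷_; here; there; lookup; tabulate; updateAt)
open import Data.Vec.Properties using
  ([]=⇒lookup; lookup⇒[]=; lookup∘tabulate; tabulate∘lookup; tabulate-cong; lookup-zipWith;
   lookup-map; lookup-replicate; lookup∘updateAt; lookup∘updateAt′; updateAt-updateAt;
   updateAt-id-local)
open import Function using (_∘_; id)
open import Function.Bundles using (mk↔ₛ′)
open import Level using (Level)
open import Relation.Binary.Core using (_Preserves_⟶_)
open import Relation.Binary.PropositionalEquality hiding ([_]; J)
open import Relation.Nullary using (¬_; yes; no; contradiction)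
open import Relation.Unary using (_⊆_)

-- The given programs are arbitrary code on the same memory as the search, so they run with all
-- names raised by 16, on the adjacency matrix of an induced subgraph copied to where they expect
-- their input. Sets within `k` changes of a given one are visited by `k` nested loops over the
-- vertices, each flipping one vertex; visiting a set repeatedly is harmless. The depths of nesting
-- are `2c + 1` and `t + c`, and each level adds a constant to the exponent of the running time:
-- this is where the linear dependence on `t` comes from. The local search runs for exactly `n`
-- rounds, as every round that starts below the size of `S` gains at least one vertex. In the second
-- phase many sets `X` are not the part outside `B` of any independent set; nothing is promised for
-- them, but what they produce is checked for independence before it may replace the best set.

private
  variable
    ℓ ℓ′ : Level
    m : ℕ

-- Subsets and induced subgraphs

∣p∩q∣+∣p∩∁q∣≡∣p∣ : ∀ (p q : Subset m) → ∣ p ∩ q ∣ + ∣ p ∩ ∁ q ∣ ≡ ∣ p ∣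
∣p∩q∣+∣p∩∁q∣≡∣p∣ []            []            = refl
∣p∩q∣+∣p∩∁q∣≡∣p∣ (outside ∷ p) (_       ∷ q) = ∣p∩q∣+∣p∩∁q∣≡∣p∣ p q
∣p∩q∣+∣p∩∁q∣≡∣p∣ (inside  ∷ p) (inside  ∷ q) = cong suc (∣p∩q∣+∣p∩∁q∣≡∣p∣ p q)
∣p∩q∣+∣p∩∁q∣≡∣p∣ (inside  ∷ p) (outside ∷ q) =
  trans (+-suc _ _) (cong suc (∣p∩q∣+∣p∩∁q∣≡∣p∣ p q))

∣p∪q∣≤∣p∣+∣q∣ : ∀ (p q : Subset m) → ∣ p ∪ q ∣ ≤ ∣ p ∣ + ∣ q ∣
∣p∪q∣≤∣p∣+∣q∣ []            []            = z≤n
∣p∪q∣≤∣p∣+∣q∣ (outside ∷ p) (outside ∷ q) = ∣p∪q∣≤∣p∣+∣q∣ p q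
∣p∪q∣≤∣p∣+∣q∣ (outside ∷ p) (inside  ∷ q) =
  ≤-trans (s≤s (∣p∪q∣≤∣p∣+∣q∣ p q)) (≤-reflexive (sym (+-suc _ _)))
∣p∪q∣≤∣p∣+∣q∣ (inside  ∷ p) (outside ∷ q) = s≤s (∣p∪q∣≤∣p∣+∣q∣ p q)
∣p∪q∣≤∣p∣+∣q∣ (inside  ∷ p) (inside  ∷ q) =
  s≤s (≤-trans (∣p∪q∣≤∣p∣+∣q∣ p q) (+-monoʳ-≤ ∣ p ∣ (n≤1+n _)))

disjoint⇒∣p∪q∣≡∣p∣+∣q∣ : ∀ (p q : Subset m) → (∀ {v} → v ∈ p → v ∉ q) →
                         ∣ p ∪ q ∣ ≡ ∣ p ∣ + ∣ q ∣
disjoint⇒∣p∪q∣≡∣p∣+∣q∣ []            []            d = refl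
disjoint⇒∣p∪q∣≡∣p∣+∣q∣ (inside  ∷ p) (inside  ∷ q) d = contradiction here (d here)
disjoint⇒∣p∪q∣≡∣p∣+∣q∣ (inside  ∷ p) (outside ∷ q) d =
  cong suc (disjoint⇒∣p∪q∣≡∣p∣+∣q∣ p q (λ x y → d (there x) (there y)))
disjoint⇒∣p∪q∣≡∣p∣+∣q∣ (outside ∷ p) (inside  ∷ q) d =
  trans (cong suc (disjoint⇒∣p∪q∣≡∣p∣+∣q∣ p q (λ x y → d (there x) (there y))))
        (sym (+-suc _ _))
disjoint⇒∣p∪q∣≡∣p∣+∣q∣ (outside ∷ p) (outside ∷ q) d =
  disjoint⇒∣p∪q∣≡∣p∣+∣q∣ p q (λ x y → d (there x) (there y))

-- Flips and the exchange step

flipAt : Fin m → Subset m → Subset m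
flipAt v U = updateAt U v not

-- `k` bounds the number of flips, as `done` is available at every `k`. The constructors match the
-- two stages of `enumerate`: the call before its loop, and one iteration of the loop.
data Flips : ℕ → Subset m → Subset m → Set where
  done : ∀ {k} {U : Subset m} → Flips k U U
  step : ∀ {k} {U Y : Subset m} v → Flips k (flipAt v U) Y → Flips (suc k) U Y

flips-∷ : ∀ {k b} {U Y : Subset m} → Flips k U Y → Flips k (b ∷ U) (b ∷ Y)
flips-∷ done       = done
flips-∷ (step v r) = step (suc v) (flips-∷ r)

flips-mono : ∀ {k l} {U Y : Subset m} → k ≤ l → Flips k U Y → Flips l U Y
flips-mono _         done       = done
flips-mono (s≤s k≤l) (step v r) = step v (flips-mono k≤l r)

-- Vertex by vertex, `Y` keeps `B ∩ S`, drops `B ∩ ∁ S` and takes the first `r` vertices of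
-- `S ∩ ∁ B`; the drops and the additions are the flips.
exchange : ∀ (B S : Subset m) r → r ≤ ∣ S ∩ ∁ B ∣ →
  ∃[ Y ] Y ⊆ˢ S × ∣ Y ∣ ≡ ∣ B ∩ S ∣ + r × Flips (∣ B ∩ ∁ S ∣ + r) B Y
exchange [] [] zero _ = [] , (λ ()) , refl , done
exchange (inside ∷ B) (inside ∷ S) r r≤ with exchange B S r r≤
... | Y , Y⊆S , size , flips = inside ∷ Y , in⊆in Y⊆S , cong suc size , flips-∷ flips
exchange (inside ∷ B) (outside ∷ S) r r≤ with exchange B S r r≤
... | Y , Y⊆S , size , flips = outside ∷ Y , out⊆ Y⊆S , size , step zero (flips-∷ flips)
exchange (outside ∷ B) (outside ∷ S) r r≤ with exchange B S r r≤
... | Y , Y⊆S , size , flips = outside ∷ Y , out⊆ Y⊆S , size , flips-∷ flips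
exchange (outside ∷ B) (inside ∷ S) zero _ with exchange B S zero z≤n
... | Y , Y⊆S , size , flips = outside ∷ Y , out⊆ Y⊆S , size , flips-∷ flips
exchange (outside ∷ B) (inside ∷ S) (suc r) (s≤s r≤) with exchange B S r r≤
... | Y , Y⊆S , size , flips =
  inside ∷ Y , in⊆in Y⊆S , trans (cong suc size) (sym (+-suc _ r)) ,
  subst (λ k → Flips k (outside ∷ B) (inside ∷ Y)) (sym (+-suc _ r)) (step zero (flips-∷ flips))

∩-comm-size : ∀ (p q : Subset m) → ∣ p ∩ q ∣ ≡ ∣ q ∩ p ∣
∩-comm-size p q = cong ∣_∣ (∩-comm p q)

improvement : ∀ {c} (B S : Subset m) → ∣ B ∩ ∁ S ∣ ≤ c → ∣ B ∣ < ∣ S ∣ →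
  ∃[ Y ] Y ⊆ˢ S × ∣ B ∣ < ∣ Y ∣ × Flips (suc (c + c)) B Y
improvement {c = c} B S ≤c B<S with exchange B S (suc ∣ B ∩ ∁ S ∣) enough
  where
  enough : ∣ B ∩ ∁ S ∣ < ∣ S ∩ ∁ B ∣
  -- Cancelling the common part `B ∩ S` turns `∣ B ∣ < ∣ S ∣` into a comparison of the two
  -- differences, which leaves room for one addition more than there are drops.
  enough = +-cancelˡ-< ∣ B ∩ S ∣ _ _ (begin-strict
    ∣ B ∩ S ∣ + ∣ B ∩ ∁ S ∣  ≡⟨ ∣p∩q∣+∣p∩∁q∣≡∣p∣ B S ⟩
    ∣ B ∣                    <⟨ B<S ⟩
    ∣ S ∣                    ≡⟨ ∣p∩q∣+∣p∩∁q∣≡∣p∣ S B ⟨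
    ∣ S ∩ B ∣ + ∣ S ∩ ∁ B ∣  ≡⟨ cong (_+ ∣ S ∩ ∁ B ∣) (∩-comm-size S B) ⟩
    ∣ B ∩ S ∣ + ∣ S ∩ ∁ B ∣  ∎)
    where open ≤-Reasoning
... | Y , Y⊆S , size , flips =
  Y , Y⊆S ,
  ≤-reflexive (sym (trans size (trans (+-suc _ _) (cong suc (∣p∩q∣+∣p∩∁q∣≡∣p∣ B S))))) ,
  flips-mono (≤-trans (+-mono-≤ ≤c (s≤s ≤c)) (≤-reflexive (+-suc c c))) flips

-- This is `exchange` from the empty set, with nothing to keep or to drop.
subset-of-size : ∀ (S : Subset m) r → r ≤ ∣ S ∣ → ∃[ Y ] Y ⊆ˢ S × ∣ Y ∣ ≡ r
subset-of-size {m} S r r≤ with exchange ⊥ S r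
  (≤-trans r≤ (p⊆q⇒∣p∣≤∣q∣ {p = S} {q = S ∩ ∁ ⊥} λ x∈S → x∈p∩q⁺ (x∈S , x∉p⇒x∈∁p ∉⊥)))
... | Y , Y⊆S , size , _ =
  Y , Y⊆S , trans size (cong (_+ r) (trans (cong ∣_∣ (∩-zeroˡ S)) (∣⊥∣≡0 m)))

flips-from-⊥ : ∀ (Y : Subset m) → Flips ∣ Y ∣ ⊥ Y
flips-from-⊥ []            = done
flips-from-⊥ (outside ∷ Y) = flips-∷ (flips-from-⊥ Y)
flips-from-⊥ (inside  ∷ Y) = step zero (flips-∷ (flips-from-⊥ Y))

-- Restriction to an induced subgraph and lifting back

restrict : (U : Subset m) → Subset m → Subset ∣ U ∣
restrict []            []      = []
restrict (inside  ∷ U) (b ∷ W) = b ∷ restrict U W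
restrict (outside ∷ U) (b ∷ W) = restrict U W

∈-restrict⁻ : ∀ (U W : Subset m) {k} → k ∈ restrict U W → enum U k ∈ W
∈-restrict⁻ (inside  ∷ U) (b ∷ W) here       = here
∈-restrict⁻ (inside  ∷ U) (b ∷ W) (there k∈) = there (∈-restrict⁻ U W k∈)
∈-restrict⁻ (outside ∷ U) (b ∷ W) k∈         = there (∈-restrict⁻ U W k∈)

∣restrict∣ : ∀ (U W : Subset m) → ∣ restrict U W ∣ ≡ ∣ U ∩ W ∣
∣restrict∣ []            []            = refl
∣restrict∣ (inside  ∷ U) (inside  ∷ W) = cong suc (∣restrict∣ U W)
∣restrict∣ (inside  ∷ U) (outside ∷ W) = ∣restrict∣ U W
∣restrict∣ (outside ∷ U) (b       ∷ W) = ∣restrict∣ U W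

∣restrict∣-⊆ : ∀ {U W : Subset m} → W ⊆ˢ U → ∣ restrict U W ∣ ≡ ∣ W ∣
∣restrict∣-⊆ {U = U} {W} W⊆U = trans (∣restrict∣ U W)
  (cong ∣_∣ (⊆-antisym (p∩q⊆q U W) λ x∈W → x∈p∩q⁺ (W⊆U x∈W , x∈W)))

-- Both sides list `W` in increasing order. The equation between sizes is irrelevant, so the
-- induction may hand `cast` any proof of it.
enum-restrict : ∀ (U W : Subset m) (W⊆U : W ⊆ˢ U) .(eq : ∣ restrict U W ∣ ≡ ∣ W ∣) i →
                enum W (cast eq i) ≡ enum U (enum (restrict U W) i)
enum-restrict []            []            W⊆U eq ()
enum-restrict (inside  ∷ U) (inside  ∷ W) W⊆U eq zero    = refl
enum-restrict (inside  ∷ U) (inside  ∷ W) W⊆U eq (suc i) =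
  cong suc (enum-restrict U W (drop-∷-⊆ W⊆U) (suc-injective eq) i)
enum-restrict (inside  ∷ U) (outside ∷ W) W⊆U eq i       =
  cong suc (enum-restrict U W (drop-∷-⊆ W⊆U) eq i)
enum-restrict (outside ∷ U) (inside  ∷ W) W⊆U eq i       with () ← W⊆U here
enum-restrict (outside ∷ U) (outside ∷ W) W⊆U eq i       =
  cong suc (enum-restrict U W (drop-∷-⊆ W⊆U) eq i)

restrict-iso : ∀ G {U W : VertexSet G} → W ⊆ˢ U → ((G [ U ]) [ restrict U W ]) ≅ (G [ W ])
restrict-iso G {U} {W} W⊆U = record
  { bijection = mk↔ₛ′ (cast eq) (cast (sym eq))
                      (cast-involutive eq (sym eq)) (cast-involutive (sym eq) eq)
  ; preserves = λ u v → cong₂ (adj G) (enum-restrict U W W⊆U eq u) (enum-restrict U W W⊆U eq v)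
  }
  where eq = ∣restrict∣-⊆ W⊆U

-- `induced` only yields a subgraph of the renumbered graph `G [ U ]`; `iso` identifies it with
-- `G [ W ]`.
hereditary-⊆ : ∀ {𝒞 : GraphClass ℓ} → Hereditary 𝒞 → ∀ G {U W : VertexSet G} →
               W ⊆ˢ U → 𝒞 (G [ U ]) → 𝒞 (G [ W ])
hereditary-⊆ h G {U} {W} W⊆U U∈𝒞 =
  Hereditary.iso h (restrict-iso G W⊆U) (Hereditary.induced h (restrict U W) U∈𝒞)

lift : (U : Subset m) → Subset ∣ U ∣ → Subset m
lift []            []      = []
lift (inside  ∷ U) (b ∷ I) = b ∷ lift U I
lift (outside ∷ U) I       = outside ∷ lift U I

∣lift∣ : ∀ (U : Subset m) I → ∣ lift U I ∣ ≡ ∣ I ∣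
∣lift∣ []            []            = refl
∣lift∣ (inside  ∷ U) (inside  ∷ I) = cong suc (∣lift∣ U I)
∣lift∣ (inside  ∷ U) (outside ∷ I) = ∣lift∣ U I
∣lift∣ (outside ∷ U) I             = ∣lift∣ U I

lift⊆ : ∀ (U : Subset m) I → lift U I ⊆ˢ U
lift⊆ (inside  ∷ U) (b ∷ I) here      = here
lift⊆ (inside  ∷ U) (b ∷ I) (there x) = there (lift⊆ U I x)
lift⊆ (outside ∷ U) I       (there x) = there (lift⊆ U I x)

∈-lift⁻ : ∀ (U : Subset m) I {v} → v ∈ lift U I → ∃[ k ] k ∈ I × enum U k ≡ v
∈-lift⁻ (inside  ∷ U) (b ∷ I) here = zero , here , refl
∈-lift⁻ (inside  ∷ U) (b ∷ I) (there v∈) with ∈-lift⁻ U I v∈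
... | k , k∈ , refl = suc k , there k∈ , refl
∈-lift⁻ (outside ∷ U) I (there v∈) with ∈-lift⁻ U I v∈
... | k , k∈ , refl = k , k∈ , refl

lift-independent : ∀ G (U : VertexSet G) {I} → Independent (G [ U ]) I → Independent G (lift U I)
lift-independent G U {I} ind u∈ v∈ with ∈-lift⁻ U I u∈ | ∈-lift⁻ U I v∈
... | _ , i∈ , refl | _ , j∈ , refl = ind i∈ j∈

restrict-independent : ∀ G (U : VertexSet G) {W} → Independent G W →
                       Independent (G [ U ]) (restrict U W)
restrict-independent G U {W} ind i∈ j∈ = ind (∈-restrict⁻ U W i∈) (∈-restrict⁻ U W j∈)

-- Positions of vertices in an induced subgraph

⟨_⟩ : Bool → ℕ
⟨ b ⟩ = if b then 1 else 0

-- On members of `U` this inverts `enum U`. The argument is a plain number, so that a loop invariant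
-- can also use it at the end, where it counts all of `U`.
rank : Subset m → ℕ → ℕ
rank []      i       = 0
rank (b ∷ U) zero    = 0
rank (b ∷ U) (suc i) = ⟨ b ⟩ + rank U i

rank-zero : ∀ (U : Subset m) → rank U 0 ≡ 0
rank-zero []      = refl
rank-zero (b ∷ U) = refl

rank-suc : ∀ (U : Subset m) v → rank U (suc (toℕ v)) ≡ rank U (toℕ v) + ⟨ lookup U v ⟩
rank-suc (b ∷ U) zero    = trans (cong (⟨ b ⟩ +_) (rank-zero U)) (+-identityʳ ⟨ b ⟩)
rank-suc (b ∷ U) (suc v) = trans (cong (⟨ b ⟩ +_) (rank-suc U v)) (sym (+-assoc ⟨ b ⟩ _ _))

rank-end : ∀ (U : Subset m) → rank U m ≡ ∣ U ∣
rank-end []            = refl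
rank-end (inside  ∷ U) = cong suc (rank-end U)
rank-end (outside ∷ U) = rank-end U

rank-enum : ∀ (U : Subset m) k → rank U (toℕ (enum U k)) ≡ toℕ k
rank-enum (inside  ∷ U) zero    = refl
rank-enum (inside  ∷ U) (suc k) = cong suc (rank-enum U k)
rank-enum (outside ∷ U) k       = rank-enum U k

rank-enum-< : ∀ (U : Subset m) k {i} → toℕ (enum U k) < i → toℕ k < rank U i
rank-enum-< (inside  ∷ U) zero    (s≤s _) = s≤s z≤n
rank-enum-< (inside  ∷ U) (suc k) (s≤s p) = s≤s (rank-enum-< U k p)
rank-enum-< (outside ∷ U) k       (s≤s p) = rank-enum-< U k p

lookup-enum : ∀ (U : Subset m) k → lookup U (enum U k) ≡ inside
lookup-enum (inside  ∷ U) zero    = refl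
lookup-enum (inside  ∷ U) (suc k) = lookup-enum U k
lookup-enum (outside ∷ U) k       = lookup-enum U k

-- Serves to read an answer that is indexed by positions in `U`: `rank` finds the position of a
-- vertex, and the conjunction masks the vertices outside `U`, whose rank is no position of their
-- own.
lookup-lift : ∀ (U : Subset m) (h : ℕ → Bool) v →
  lookup (lift U (tabulate (h ∘ toℕ))) v ≡ lookup U v ∧ h (rank U (toℕ v))
lookup-lift (inside  ∷ U) h zero    = refl
lookup-lift (inside  ∷ U) h (suc v) = lookup-lift U (h ∘ suc) v
lookup-lift (outside ∷ U) h zero    = refl
lookup-lift (outside ∷ U) h (suc v) = lookup-lift U h v

-- Bounds from a sparse-dense partition

module Partition {ℓ₁ ℓ₂ : Level} {𝒮 : GraphClass ℓ₁} {𝒟 : GraphClass ℓ₂} (classes : SparseDenseClasses 𝒮 𝒟)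
                 {G : Graph} (partition : SparseDensePartition 𝒮 𝒟 G) where

  open SparseDenseClasses classes
  open SparseDensePartition partition

  ∉S⇒∈D : ∀ {v} → v ∉ S → v ∈ D
  ∉S⇒∈D {v} v∉S with x∈p∪q⁻ S D (subst (v ∈_) (sym cover) ∈⊤)
  ... | inj₁ v∈S = contradiction v∈S v∉S
  ... | inj₂ v∈D = v∈D

  sparse-outside-S : ∀ (B : VertexSet G) → 𝒮 (G [ B ]) → ∣ B ∩ ∁ S ∣ ≤ c
  sparse-outside-S B B∈𝒮 = ≤-trans
    (p⊆q⇒∣p∣≤∣q∣ λ v∈ → let v∈B , v∉S = x∈p∩q⁻ B (∁ S) v∈ in
                        x∈p∩q⁺ (v∈B , ∉S⇒∈D (x∈∁p⇒x∉p v∉S)))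
    (bounded G B D B∈𝒮 dense)

  S-outside-large : ∀ (B : VertexSet G) → 𝒮 (G [ B ]) → ∣ S ∣ ≤ ∣ B ∣ → ∣ S ∩ ∁ B ∣ ≤ c
  S-outside-large B B∈𝒮 S≤B = +-cancelˡ-≤ ∣ S ∩ B ∣ _ _ (begin
    ∣ S ∩ B ∣ + ∣ S ∩ ∁ B ∣  ≡⟨ ∣p∩q∣+∣p∩∁q∣≡∣p∣ S B ⟩
    ∣ S ∣                    ≤⟨ S≤B ⟩
    ∣ B ∣                    ≡⟨ ∣p∩q∣+∣p∩∁q∣≡∣p∣ B S ⟨
    ∣ B ∩ S ∣ + ∣ B ∩ ∁ S ∣  ≡⟨ cong (_+ ∣ B ∩ ∁ S ∣) (∩-comm-size B S) ⟩
    ∣ S ∩ B ∣ + ∣ B ∩ ∁ S ∣  ≤⟨ +-monoʳ-≤ ∣ S ∩ B ∣ (sparse-outside-S B B∈𝒮) ⟩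
    ∣ S ∩ B ∣ + c            ∎)
    where open ≤-Reasoning

  module _ {t : ℕ} (co-Kₜ-free : ∀ {H} → 𝒟 H → CoKFree t H) where

    -- `CoKFree` forbids exactly `t` vertices, so a larger set is first cut down to `t`. Heredity
    -- puts `G [ Y ]` into `𝒟`, and there the independent set is simply `⊤`.
    independent-in-D : ∀ W → Independent G W → W ⊆ˢ D → ∣ W ∣ < t
    independent-in-D W ind W⊆D = ≰⇒> λ t≤W →
      let Y , Y⊆W , size = subset-of-size W t t≤W in
      co-Kₜ-free (hereditary-⊆ dense-hereditary G (λ v∈Y → W⊆D (Y⊆W v∈Y)) dense) ⊤
        (λ {i} {j} _ _ → ind (Y⊆W (lookup⇒[]= _ _ (lookup-enum Y i)))
                             (Y⊆W (lookup⇒[]= _ _ (lookup-enum Y j))))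
        (trans (∣⊤∣≡n ∣ Y ∣) size)

    independent-outside-large : ∀ B → 𝒮 (G [ B ]) → ∣ S ∣ ≤ ∣ B ∣ →
      ∀ W → Independent G W → ∣ W ∩ ∁ B ∣ ≤ t + c
    independent-outside-large B B∈𝒮 S≤B W ind = begin
      ∣ W ∩ ∁ B ∣                      ≤⟨ p⊆q⇒∣p∣≤∣q∣ split ⟩
      ∣ (W ∩ D) ∪ (S ∩ ∁ B) ∣          ≤⟨ ∣p∪q∣≤∣p∣+∣q∣ (W ∩ D) (S ∩ ∁ B) ⟩
      ∣ W ∩ D ∣ + ∣ S ∩ ∁ B ∣          ≤⟨ +-mono-≤ (<⇒≤ W∩D<t) (S-outside-large B B∈𝒮 S≤B) ⟩
      t + c                            ∎
      where
      open ≤-Reasoning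
      W∩D<t : ∣ W ∩ D ∣ < t
      W∩D<t = independent-in-D (W ∩ D)
        (λ u∈ v∈ → ind (p∩q⊆p W D u∈) (p∩q⊆p W D v∈)) (p∩q⊆q W D)
      split : W ∩ ∁ B ⊆ˢ (W ∩ D) ∪ (S ∩ ∁ B)
      split {v} v∈ with x∈p∩q⁻ W (∁ B) v∈ | v ∈? S
      ... | v∈W , v∈∁B | yes v∈S = x∈p∪q⁺ (inj₂ (x∈p∩q⁺ (v∈S , v∈∁B)))
      ... | v∈W , v∈∁B | no  v∉S = x∈p∪q⁺ (inj₁ (x∈p∩q⁺ (v∈W , ∉S⇒∈D v∉S)))

-- Completing the part of an independent set outside `B`

module _ (G : Graph) where

  NonAdjacent : VertexSet G → Fin (order G) → Set
  NonAdjacent X v = ∀ {u} → u ∈ X → adj G v u ≡ false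

  -- Y is B \ N[X]
  record Free (B X Y : VertexSet G) : Set where
    field
      ⊆B          : Y ⊆ˢ B
      avoids      : ∀ {v} → v ∈ Y → v ∉ X
      nonadjacent : ∀ {v} → v ∈ Y → NonAdjacent X v
      complete    : ∀ {v} → v ∈ B → v ∉ X → NonAdjacent X v → v ∈ Y

  module _ {B W Y : VertexSet G} (free : Free B (W ∩ ∁ B) Y) {I : Subset ∣ Y ∣}
           (ind : Independent G W) (best : MaximumIndependent (G [ Y ]) I) where

    open Free free

    -- As `W` is independent, `W ∩ B` avoids `W ∩ ∁ B` and its neighbours, so it lies in `Y` and
    -- competes with `I` there. The union loses nothing, since `Y` is disjoint from `W ∩ ∁ B`.
    extension-size : ∣ W ∣ ≤ ∣ (W ∩ ∁ B) ∪ lift Y I ∣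
    extension-size = begin
      ∣ W ∣                              ≡⟨ ∣p∩q∣+∣p∩∁q∣≡∣p∣ W B ⟨
      ∣ W ∩ B ∣ + ∣ W ∩ ∁ B ∣            ≡⟨ +-comm ∣ W ∩ B ∣ _ ⟩
      ∣ W ∩ ∁ B ∣ + ∣ W ∩ B ∣            ≤⟨ +-monoʳ-≤ ∣ W ∩ ∁ B ∣ W∩B≤I ⟩
      ∣ W ∩ ∁ B ∣ + ∣ lift Y I ∣         ≡⟨ disjoint⇒∣p∪q∣≡∣p∣+∣q∣ (W ∩ ∁ B) (lift Y I)
                                            (λ v∈X v∈L → avoids (lift⊆ Y I v∈L) v∈X) ⟨
      ∣ (W ∩ ∁ B) ∪ lift Y I ∣           ∎
      where
      open ≤-Reasoning
      W∩B⊆Y∩W : W ∩ B ⊆ˢ Y ∩ W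
      W∩B⊆Y∩W v∈ with x∈p∩q⁻ W B v∈
      ... | v∈W , v∈B = x∈p∩q⁺
        ( complete v∈B (λ v∈X → x∈∁p⇒x∉p (p∩q⊆q W (∁ B) v∈X) v∈B)
                       (λ u∈X → ind v∈W (p∩q⊆p W (∁ B) u∈X))
        , v∈W )
      W∩B≤I : ∣ W ∩ B ∣ ≤ ∣ lift Y I ∣
      W∩B≤I = begin
        ∣ W ∩ B ∣         ≤⟨ p⊆q⇒∣p∣≤∣q∣ W∩B⊆Y∩W ⟩
        ∣ Y ∩ W ∣         ≡⟨ ∣restrict∣ Y W ⟨
        ∣ restrict Y W ∣  ≤⟨ proj₂ best _ (restrict-independent G Y ind) ⟩
        ∣ I ∣             ≡⟨ ∣lift∣ Y I ⟨
        ∣ lift Y I ∣      ∎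

    extension-independent : Independent G ((W ∩ ∁ B) ∪ lift Y I)
    extension-independent {u} {v} u∈ v∈
      with x∈p∪q⁻ (W ∩ ∁ B) (lift Y I) u∈ | x∈p∪q⁻ (W ∩ ∁ B) (lift Y I) v∈
    ... | inj₁ u∈X | inj₁ v∈X = ind (p∩q⊆p W (∁ B) u∈X) (p∩q⊆p W (∁ B) v∈X)
    ... | inj₁ u∈X | inj₂ v∈L = trans (symm G u v) (nonadjacent (lift⊆ Y I v∈L) u∈X)
    ... | inj₂ u∈L | inj₁ v∈X = nonadjacent (lift⊆ Y I u∈L) v∈X
    ... | inj₂ u∈L | inj₂ v∈L = lift-independent G Y (proj₁ best) u∈L v∈L

-- Running times of structured programs

-- Yields `1 ≤ T` from a run of the given recogniser, so that powers of `N` times `T` can absorb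
-- constants.
1≤steps : ∀ {P σ τ k} → ⟨ P , σ ⟩⇓⟨ τ , k ⟩ → 1 ≤ k
1≤steps ⇓skip         = s≤s z≤n
1≤steps ⇓reg          = s≤s z≤n
1≤steps ⇓arr          = s≤s z≤n
1≤steps (⇓seq r _)    = m≤n⇒m≤n+o _ (1≤steps r)
1≤steps (⇓then _ _)   = s≤s z≤n
1≤steps (⇓else _ _)   = s≤s z≤n
1≤steps (⇓stop _)     = s≤s z≤n
1≤steps (⇓again _ _ _) = s≤s z≤n

-- Renaming by a closed numeral makes 16 + y ≡ᵇ 16 + x reduce to y ≡ᵇ x, so
-- that updates commute with `upper` definitionally.
shiftExpr : Expr → Expr
shiftExpr (lit k)    = lit k
shiftExpr (var x)    = var (16 + x)
shiftExpr (e ⊕ f)    = shiftExpr e ⊕ shiftExpr f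
shiftExpr (e ⊖ f)    = shiftExpr e ⊖ shiftExpr f
shiftExpr (read a e) = read (16 + a) (shiftExpr e)

shift : Program → Program
shift skip          = skip
shift (x ≔ e)       = 16 + x ≔ shiftExpr e
shift (a ⟨ e ⟩≔ f)  = (16 + a) ⟨ shiftExpr e ⟩≔ shiftExpr f
shift (P ⨾ Q)       = shift P ⨾ shift Q
shift (ifnz e P Q)  = ifnz (shiftExpr e) (shift P) (shift Q)
shift (whilenz e P) = whilenz (shiftExpr e) (shift P)

upper : State → State
upper σ = record { reg = λ x → reg σ (16 + x) ; arr = λ a → arr σ (16 + a) }

⟦shiftExpr⟧ : ∀ e σ → ⟦ shiftExpr e ⟧ σ ≡ ⟦ e ⟧ (upper σ)
⟦shiftExpr⟧ (lit k)    σ = refl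
⟦shiftExpr⟧ (var x)    σ = refl
⟦shiftExpr⟧ (e ⊕ f)    σ = cong₂ _+_ (⟦shiftExpr⟧ e σ) (⟦shiftExpr⟧ f σ)
⟦shiftExpr⟧ (e ⊖ f)    σ = cong₂ _∸_ (⟦shiftExpr⟧ e σ) (⟦shiftExpr⟧ f σ)
⟦shiftExpr⟧ (read a e) σ = cong (arr σ (16 + a)) (⟦shiftExpr⟧ e σ)

cost-shiftExpr : ∀ e → cost (shiftExpr e) ≡ cost e
cost-shiftExpr (lit k)    = refl
cost-shiftExpr (var x)    = refl
cost-shiftExpr (e ⊕ f)    = cong suc (cong₂ _+_ (cost-shiftExpr e) (cost-shiftExpr f))
cost-shiftExpr (e ⊖ f)    = cong suc (cong₂ _+_ (cost-shiftExpr e) (cost-shiftExpr f))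
cost-shiftExpr (read a e) = cong suc (cost-shiftExpr e)

with-steps : ∀ {P σ τ k l} → k ≡ l → ⟨ P , σ ⟩⇓⟨ τ , k ⟩ → ⟨ P , σ ⟩⇓⟨ τ , l ⟩
with-steps refl r = r

-- Induction on a run needs a variable as its start state, hence the equation with `upper σ`. Costs
-- agree exactly, as they do not depend on names.
shift-run : ∀ {P σ′ τ′ k} → ⟨ P , σ′ ⟩⇓⟨ τ′ , k ⟩ → ∀ σ → σ′ ≡ upper σ →
            ∃[ τ ] ⟨ shift P , σ ⟩⇓⟨ τ , k ⟩ × τ′ ≡ upper τ
shift-run ⇓skip σ refl = σ , ⇓skip , refl
shift-run (⇓reg {x = x} {e}) σ refl =
  _ , with-steps (cong suc (cost-shiftExpr e)) ⇓reg ,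
  cong (λ k → setReg x k (upper σ)) (sym (⟦shiftExpr⟧ e σ))
shift-run (⇓arr {a = a} {e} {f}) σ refl =
  _ , with-steps (cong₂ (λ c d → suc (c + d)) (cost-shiftExpr e) (cost-shiftExpr f)) ⇓arr ,
  cong₂ (λ i k → setArr a i k (upper σ)) (sym (⟦shiftExpr⟧ e σ)) (sym (⟦shiftExpr⟧ f σ))
shift-run (⇓seq r s) σ refl with shift-run r σ refl
... | τ , r′ , eq with shift-run s τ eq
...   | υ , s′ , eq′ = υ , ⇓seq r′ s′ , eq′
shift-run (⇓then {e = e} e≢0 r) σ refl with shift-run r σ refl
... | τ , r′ , eq = τ ,
  with-steps (cong (λ c → suc (c + _)) (cost-shiftExpr e))
        (⇓then (e≢0 ∘ trans (sym (⟦shiftExpr⟧ e σ))) r′) , eq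
shift-run (⇓else {e = e} e≡0 r) σ refl with shift-run r σ refl
... | τ , r′ , eq = τ ,
  with-steps (cong (λ c → suc (c + _)) (cost-shiftExpr e))
        (⇓else (trans (⟦shiftExpr⟧ e σ) e≡0) r′) , eq
shift-run (⇓stop {e = e} e≡0) σ refl =
  σ , with-steps (cong suc (cost-shiftExpr e))
            (⇓stop (trans (⟦shiftExpr⟧ e σ) e≡0)) , refl
shift-run (⇓again {e = e} e≢0 r s) σ refl with shift-run r σ refl
... | τ , r′ , eq with shift-run s τ eq
...   | υ , s′ , eq′ = υ ,
  with-steps (cong (λ c → suc (c + _ + _)) (cost-shiftExpr e))
        (⇓again (e≢0 ∘ trans (sym (⟦shiftExpr⟧ e σ))) r′ s′) , eq′

-- A syntactic check that computes on concrete programs, so that `refl` proves a register unchanged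
-- however often loops repeat.
keepsReg : ℕ → Program → Bool
keepsReg x skip          = true
keepsReg x (y ≔ e)       = not (x ≡ᵇ y)
keepsReg x (a ⟨ e ⟩≔ f)  = true
keepsReg x (P ⨾ Q)       = keepsReg x P ∧ keepsReg x Q
keepsReg x (ifnz e P Q)  = keepsReg x P ∧ keepsReg x Q
keepsReg x (whilenz e P) = keepsReg x P

keepsArr : ℕ → Program → Bool
keepsArr b skip          = true
keepsArr b (y ≔ e)       = true
keepsArr b (a ⟨ e ⟩≔ f)  = not (b ≡ᵇ a)
keepsArr b (P ⨾ Q)       = keepsArr b P ∧ keepsArr b Q
keepsArr b (ifnz e P Q)  = keepsArr b P ∧ keepsArr b Q
keepsArr b (whilenz e P) = keepsArr b P

reg-kept : ∀ {P σ τ k} x → ⟨ P , σ ⟩⇓⟨ τ , k ⟩ → keepsReg x P ≡ true → reg τ x ≡ reg σ x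
reg-kept x ⇓skip _ = refl
reg-kept x (⇓reg {x = y}) kept rewrite not-injective {x ≡ᵇ y} {false} kept = refl
reg-kept x ⇓arr _ = refl
reg-kept x (⇓seq r s) kept =
  trans (reg-kept x s (∧-conicalʳ _ _ kept)) (reg-kept x r (∧-conicalˡ _ _ kept))
reg-kept x (⇓then _ r) kept = reg-kept x r (∧-conicalˡ _ _ kept)
reg-kept x (⇓else {P = P} _ r) kept = reg-kept x r (∧-conicalʳ (keepsReg x P) _ kept)
reg-kept x (⇓stop _) kept = refl
reg-kept x (⇓again _ r s) kept = trans (reg-kept x s kept) (reg-kept x r kept)

arr-kept : ∀ {P σ τ k} b → ⟨ P , σ ⟩⇓⟨ τ , k ⟩ → keepsArr b P ≡ true → arr τ b ≡ arr σ b
arr-kept b ⇓skip _ = refl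
arr-kept b ⇓reg _ = refl
arr-kept b (⇓arr {a = a}) kept rewrite not-injective {b ≡ᵇ a} {false} kept = refl
arr-kept b (⇓seq {P = P} r s) kept =
  trans (arr-kept b s (∧-conicalʳ (keepsArr b P) _ kept)) (arr-kept b r (∧-conicalˡ _ _ kept))
arr-kept b (⇓then _ r) kept = arr-kept b r (∧-conicalˡ _ _ kept)
arr-kept b (⇓else {P = P} _ r) kept = arr-kept b r (∧-conicalʳ (keepsArr b P) _ kept)
arr-kept b (⇓stop _) kept = refl
arr-kept b (⇓again _ r s) kept = trans (arr-kept b s kept) (arr-kept b r kept)

-- Refers to the program but not to a run, and is therefore closed under repetition: a loop can hand
-- its body one `Frame` reaching from before the loop to the current iteration.
record Frame (P : Program) (σ τ : State) : Set where
  field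
    keepReg : ∀ x → keepsReg x P ≡ true → reg τ x ≡ reg σ x
    keepArr : ∀ a → keepsArr a P ≡ true → arr τ a ≡ arr σ a

open Frame public

frame : ∀ {P σ τ k} → ⟨ P , σ ⟩⇓⟨ τ , k ⟩ → Frame P σ τ
frame r = record { keepReg = λ x → reg-kept x r ; keepArr = λ a → arr-kept a r }

frame-trans : ∀ {P σ τ υ} → Frame P σ τ → Frame P τ υ → Frame P σ υ
frame-trans f g = record
  { keepReg = λ x kept → trans (keepReg g x kept) (keepReg f x kept)
  ; keepArr = λ a kept → trans (keepArr g a kept) (keepArr f a kept)
  }

frame-⨾ : ∀ {P Q σ τ υ} → Frame P σ τ → Frame Q τ υ → Frame (P ⨾ Q) σ υ
frame-⨾ {P} f g = record
  { keepReg = λ x kept → trans (keepReg g x (∧-conicalʳ (keepsReg x P) _ kept))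
                               (keepReg f x (∧-conicalˡ _ _ kept))
  ; keepArr = λ a kept → trans (keepArr g a (∧-conicalʳ (keepsArr a P) _ kept))
                               (keepArr f a (∧-conicalˡ _ _ kept))
  }

≡ᵇ-refl : ∀ x → (x ≡ᵇ x) ≡ true
≡ᵇ-refl zero    = refl
≡ᵇ-refl (suc x) = ≡ᵇ-refl x

≢⇒≡ᵇ-false : ∀ {x y} → x ≢ y → (x ≡ᵇ y) ≡ false
≢⇒≡ᵇ-false {x} {y} x≢y = ¬-not λ eq → x≢y (≡ᵇ⇒≡ x y (subst IsTrue (sym eq) _))

low≢shifted : ∀ {x y} → x < 16 → not (x ≡ᵇ 16 + y) ≡ true
low≢shifted {x} {y} x<16 = cong not (≢⇒≡ᵇ-false {x} {16 + y} λ { refl → <⇒≱ x<16 (m≤m+n 16 y) })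

shift-keepsReg : ∀ P {x} → x < 16 → keepsReg x (shift P) ≡ true
shift-keepsReg skip          x<16 = refl
shift-keepsReg (y ≔ e)       x<16 = low≢shifted x<16
shift-keepsReg (a ⟨ e ⟩≔ f)  x<16 = refl
shift-keepsReg (P ⨾ Q)       x<16 = cong₂ _∧_ (shift-keepsReg P x<16) (shift-keepsReg Q x<16)
shift-keepsReg (ifnz e P Q)  x<16 = cong₂ _∧_ (shift-keepsReg P x<16) (shift-keepsReg Q x<16)
shift-keepsReg (whilenz e P) x<16 = shift-keepsReg P x<16

shift-keepsArr : ∀ P {x} → x < 16 → keepsArr x (shift P) ≡ true
shift-keepsArr skip          x<16 = refl
shift-keepsArr (y ≔ e)       x<16 = refl
shift-keepsArr (a ⟨ e ⟩≔ f)  x<16 = low≢shifted x<16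
shift-keepsArr (P ⨾ Q)       x<16 = cong₂ _∧_ (shift-keepsArr P x<16) (shift-keepsArr Q x<16)
shift-keepsArr (ifnz e P Q)  x<16 = cong₂ _∧_ (shift-keepsArr P x<16) (shift-keepsArr Q x<16)
shift-keepsArr (whilenz e P) x<16 = shift-keepsArr P x<16

-- The literal comes first in the increment, so that its value reduces to `suc` of the old counter.
for : ℕ → ℕ → Program → Program
for x m P = x ≔ lit 0 ⨾ whilenz (var m ⊖ var x) (P ⨾ x ≔ lit 1 ⊕ var x)

-- Running times are only tracked up to the exponent e in N ^ e * T: as 2 ≤ N
-- and 1 ≤ T, every constant factor is absorbed into the exponent.
module Timed (n T : ℕ) (1≤T : 1 ≤ T) where

  N : ℕ
  N = 2 ⊔ n

  budget : ℕ → ℕ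
  budget e = N ^ e * T

  -- A record, so that unification can read off `e`, which in `budget e` would be buried under
  -- `_^_`.
  record Runs (e : ℕ) (P : Program) (σ : State) (Post : State → Set ℓ) : Set ℓ where
    constructor runs
    field
      halts : HaltsWithin P σ (budget e) Post

  2≤N : 2 ≤ N
  2≤N = m≤m⊔n 2 n

  instance
    N-nonZero : NonZero N
    N-nonZero = >-nonZero (<-≤-trans (s≤s z≤n) 2≤N)

  budget-mono : ∀ {e f} → e ≤ f → budget e ≤ budget f
  budget-mono e≤f = *-monoˡ-≤ T (^-monoʳ-≤ N e≤f)

  N*budget : ∀ e → N * budget e ≡ budget (suc e)
  N*budget e = sym (*-assoc N (N ^ e) T)

  budget+budget : ∀ e → budget e + budget e ≤ budget (suc e)
  budget+budget e = begin
    budget e + budget e        ≡⟨ cong (budget e +_) (+-identityʳ (budget e)) ⟨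
    2 * budget e               ≤⟨ *-monoˡ-≤ (budget e) 2≤N ⟩
    N * budget e               ≡⟨ N*budget e ⟩
    budget (suc e)             ∎
    where open ≤-Reasoning

  2^≤budget : ∀ e → 2 ^ e ≤ budget e
  2^≤budget e = begin
    2 ^ e      ≤⟨ ^-monoˡ-≤ e 2≤N ⟩
    N ^ e      ≡⟨ *-identityʳ (N ^ e) ⟨
    N ^ e * 1  ≤⟨ *-monoʳ-≤ (N ^ e) 1≤T ⟩
    N ^ e * T  ∎
    where open ≤-Reasoning

  -- As `64 = 2 ^ 6 ≤ N ^ 6`, one exponent serves all loop-free fragments; `straight` checks their
  -- step counts by evaluation.
  ≤64⇒≤budget : ∀ e {k} → k ≤ 64 → k ≤ budget (6 + e)
  ≤64⇒≤budget e k≤64 = ≤-trans k≤64 (≤-trans (2^≤budget 6) (budget-mono (m≤m+n 6 e)))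

  weaken : ∀ {e f P σ} {Q : State → Set ℓ} {Q′ : State → Set ℓ′} → e ≤ f → (∀ {τ} → Q τ → Q′ τ) →
           Runs e P σ Q → Runs f P σ Q′
  weaken e≤f imp (runs (τ , k , r , k≤ , q)) = runs (τ , k , r , ≤-trans k≤ (budget-mono e≤f) , imp q)

  straight : ∀ {P σ τ k} {Q : State → Set ℓ} → ⟨ P , σ ⟩⇓⟨ τ , k ⟩ → {_ : IsTrue (k ≤ᵇ 64)} →
             Q τ → Runs 6 P σ Q
  straight {k = k} r {k≤} q = runs (_ , k , r , ≤64⇒≤budget 0 (≤ᵇ⇒≤ k 64 k≤) , q)

  assign : ∀ {x e σ} → {_ : IsTrue (cost e <ᵇ 64)} → Runs 6 (x ≔ e) σ (_≡ setReg x (⟦ e ⟧ σ) σ)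
  assign {e = e} {_} {cheap} = straight ⇓reg {cheap} refl

  framed : ∀ {e P σ} {A : State → Set ℓ} → Runs e P σ A → Runs e P σ (λ τ → Frame P σ τ × A τ)
  framed (runs (τ , k , r , k≤ , a)) = runs (τ , k , r , k≤ , frame r , a)

  within : ∀ {e f P σ} {A : State → Set ℓ} → e ≤ f → Runs e P σ A → HaltsWithin P σ (T * N ^ f) A
  within {f = f} e≤f (runs (τ , k , r , k≤ , a)) =
    τ , k , r , ≤-trans k≤ (≤-trans (budget-mono e≤f) (≤-reflexive (*-comm (N ^ f) T))) , a

  shift-runs : ∀ {P σ b} {A : State → Set ℓ} → b ≤ T → HaltsWithin P (upper σ) b A →
               Runs 0 (shift P) σ (λ τ → A (upper τ))
  shift-runs {A = A} b≤T (_ , k , r , k≤b , a) with shift-run r _ refl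
  ... | τ , r′ , eq = runs
    (τ , k , r′ , ≤-trans k≤b (≤-trans b≤T (≤-reflexive (sym (*-identityˡ T)))) , subst A eq a)

  -- Doubling a budget costs at most a factor `N`. The common exponent matters for recursive
  -- programs: `enumerate` calls itself twice, and adding exponents as in `seq-rule` would double
  -- them at each level.
  seq-rule-⊔ : ∀ {e P Q σ} {A : State → Set ℓ} {B : State → Set ℓ′} → Runs e P σ A →
               (∀ {τ} → Frame P σ τ → A τ → Runs e Q τ B) → Runs (suc e) (P ⨾ Q) σ B
  seq-rule-⊔ {e = e} (runs (τ , k , r , k≤ , a)) next with next (frame r) a
  ... | runs (υ , l , s , l≤ , b) = runs
    (υ , k + l , ⇓seq r s , ≤-trans (+-mono-≤ k≤ l≤) (budget+budget e) , b)

  -- Sums instead of maxima: closed exponents compute, and the exponent of the whole algorithm is a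
  -- polynomial in `c` and `t`.
  seq-rule : ∀ {e f P Q σ} {A : State → Set ℓ} {B : State → Set ℓ′} → Runs e P σ A →
             (∀ {τ} → Frame P σ τ → A τ → Runs f Q τ B) → Runs (suc (e + f)) (P ⨾ Q) σ B
  seq-rule {e = e} {f} P-runs next = seq-rule-⊔ (weaken (m≤m+n e f) id P-runs)
    λ g a → weaken (m≤n+m f e) id (next g a)

  guard+branch≤ : ∀ e {g k} → g ≤ 63 → k ≤ budget e → suc g + k ≤ budget (7 + e)
  guard+branch≤ e g≤ k≤ = ≤-trans
    (+-mono-≤ (≤64⇒≤budget e (s≤s g≤)) (≤-trans k≤ (budget-mono (m≤n+m e 6))))
    (budget+budget (6 + e))

  if-rule : ∀ {e c P Q σ} {A : State → Set ℓ} → cost c ≤ 63 →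
            (⟦ c ⟧ σ ≢ 0 → Runs e P σ A) → (⟦ c ⟧ σ ≡ 0 → Runs e Q σ A) →
            Runs (7 + e) (ifnz c P Q) σ A
  if-rule {e = e} {c} {P} {Q} {σ} c≤ P-runs Q-runs with ⟦ c ⟧ σ in eq
  ... | zero  = let runs (τ , k , r , k≤ , a) = Q-runs refl in
    runs (τ , _ , ⇓else eq r , guard+branch≤ e c≤ k≤ , a)
  ... | suc _ = let runs (τ , k , r , k≤ , a) = P-runs (λ ()) in
    runs (τ , _ , ⇓then (λ c≡0 → contradiction (trans (sym eq) c≡0) λ ()) r , guard+branch≤ e c≤ k≤ , a)

  while-rule : ∀ {e c P σ} (I : ℕ → State → Set ℓ) L → L ≤ N → cost c ≤ 63 →
    (∀ {i τ} → I i τ → i < L → ⟦ c ⟧ τ ≢ 0) → (∀ {τ} → I L τ → ⟦ c ⟧ τ ≡ 0) →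
    (∀ (i : Fin L) τ → I (toℕ i) τ → Runs e P τ (I (suc (toℕ i)))) →
    I 0 σ → Runs (9 + e) (whilenz c P) σ (I L)
  while-rule {e = e} {c} {P} {σ} I L L≤N c≤ enter exit body I0 =
    let τ , k , r , k≤ , IL = loop L 0 σ refl I0 in runs (τ , k , r , ≤-trans k≤ total , IL)
    where
    loop : ∀ r i τ → i + r ≡ L → I i τ →
           HaltsWithin (whilenz c P) τ (r * (suc (cost c) + budget e) + suc (cost c)) (I L)
    loop zero i τ eq Ii with refl ← trans (sym (+-identityʳ i)) eq =
      τ , _ , ⇓stop (exit Ii) , ≤-refl , Ii
    loop (suc r) i τ eq Ii
      with body (fromℕ< i<L) τ (subst (λ j → I j τ) (sym (toℕ-fromℕ< i<L)) Ii)
      where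
      i<L : i < L
      i<L = subst (i <_) eq (m<m+n i (s≤s z≤n))
    ... | runs (υ , k , s , k≤ , Isuc)
      with loop r (suc i) υ (trans (sym (+-suc i r)) eq)
                (subst (λ j → I (suc j) υ) (toℕ-fromℕ< _) Isuc)
    ... | ω , l , w , l≤ , IL = ω , _ ,
      ⇓again (enter Ii (subst (i <_) eq (m<m+n i (s≤s z≤n)))) s w ,
      ≤-trans (+-mono-≤ (+-monoʳ-≤ (suc (cost c)) k≤) l≤)
              (≤-reflexive (sym (+-assoc (suc (cost c) + budget e) (r * (suc (cost c) + budget e)) _))) , IL
    open ≤-Reasoning
    total : L * (suc (cost c) + budget e) + suc (cost c) ≤ budget (9 + e)
    -- Seven for the guard beside the body, one for the at most `N` rounds, one for adding the last,
    -- failing guard.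
    total = begin
      L * (suc (cost c) + budget e) + suc (cost c)
        ≤⟨ +-mono-≤ (*-mono-≤ L≤N (guard+branch≤ e c≤ ≤-refl)) (≤64⇒≤budget (2 + e) (s≤s c≤)) ⟩
      N * budget (7 + e) + budget (8 + e)
        ≡⟨ cong (_+ budget (8 + e)) (N*budget (7 + e)) ⟩
      budget (8 + e) + budget (8 + e)
        ≤⟨ budget+budget (8 + e) ⟩
      budget (9 + e) ∎

  -- The body answers for the state as it will be after the increment, whose own frame and cost are
  -- settled here once: `23 = 1 + 6 + 9 + 1 + 6`.
  for-rule : ∀ {e x m P σ} (I : ℕ → State → Set ℓ) L → L ≤ N → reg σ m ≡ L →
    keepsReg x P ≡ true → keepsReg m (for x m P) ≡ true →
    I 0 (setReg x 0 σ) →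
    (∀ (i : Fin L) τ → Frame (for x m P) σ τ → reg τ x ≡ toℕ i → I (toℕ i) τ →
      Runs e P τ (λ υ → I (suc (toℕ i)) (setReg x (suc (toℕ i)) υ))) →
    Runs (23 + e) (for x m P) σ (I L)
  for-rule {e = e} {x} {m} {P} {σ} I L L≤N m≡L keep-x keep-m I0 body =
    weaken (≤-reflexive arith) proj₂
      (seq-rule {e = 6} {f = 9 + suc (e + 6)} {A = J 0}
        (straight ⇓reg ((record { keepReg = λ y kept → reg-kept y (⇓reg {σ} {x} {lit 0}) (∧-conicalˡ _ _ kept)
                                ; keepArr = λ a kept → refl } ,
                         cong (if_then 0 else reg σ x) (≡ᵇ-refl x)) , I0))
        (λ {τ} _ → while-rule J L L≤N (≤ᵇ⇒≤ 3 63 _) enter exit iteration))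
    where
    arith : suc (6 + (9 + suc (e + 6))) ≡ 23 + e
    arith = cong (17 +_) (+-comm e 6)
    J : ℕ → State → Set _
    J i τ = (Frame (for x m P) σ τ × reg τ x ≡ i) × I i τ
    m-kept : ∀ {i τ} → J i τ → reg τ m ≡ L
    m-kept ((f , _) , _) = trans (keepReg f m keep-m) m≡L
    enter : ∀ {i τ} → J i τ → i < L → reg τ m ∸ reg τ x ≢ 0
    enter j@((f , refl) , _) i<L eq = <⇒≱ i<L (≤-trans (≤-reflexive (sym (m-kept j))) (m∸n≡0⇒m≤n eq))
    exit : ∀ {τ} → J L τ → reg τ m ∸ reg τ x ≡ 0
    exit j@((f , x≡L) , _) = m≤n⇒m∸n≡0 (≤-reflexive (trans (m-kept j) (sym x≡L)))
    iteration : ∀ (i : Fin L) τ → J (toℕ i) τ →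
                Runs (suc (e + 6)) (P ⨾ x ≔ lit 1 ⊕ var x) τ (J (suc (toℕ i)))
    iteration i τ ((f , x≡i) , Ii) = seq-rule {e = e} {f = 6} (body i τ f x≡i Ii) λ {υ} g Isuc →
      let x′ = trans (keepReg g x keep-x) x≡i
          run = ⇓reg {υ} {x} {lit 1 ⊕ var x}
      in straight run
        ( ( frame-trans f (record
              { keepReg = λ y kept → keepReg (frame-⨾ g (frame run)) y
                                       (∧-conicalʳ (not (y ≡ᵇ x)) _ kept)
              ; keepArr = λ a kept → keepArr (frame-⨾ g (frame run)) a kept })
          , trans (cong (if_then suc (reg υ x) else reg υ x) (≡ᵇ-refl x)) (cong suc x′) )
        , subst (λ v → I (suc (toℕ i)) (setReg x (suc v) υ)) (sym x′) Isuc )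

-- Loops over the vertices

nonzero : ℕ → Bool
nonzero x = not (x ≡ᵇ 0)

chars : ∀ {n} → (ℕ → ℕ) → Subset n
chars f = tabulate (λ v → nonzero (f (toℕ v)))

lookup-chars : ∀ {n} f (v : Fin n) → lookup (chars f) v ≡ nonzero (f (toℕ v))
lookup-chars f v = lookup∘tabulate _ v

notₑ : Expr → Expr
notₑ e = lit 1 ⊖ e

-- Arrays may mark members by any nonzero number, while `members` adds the marks up and needs exact
-- bits.
bitₑ : Expr → Expr
bitₑ e = notₑ (notₑ e)

-- De Morgan's law, with addition as disjunction and truncated subtraction from 1 as negation.
andₑ : Expr → Expr → Expr
andₑ e f = notₑ (notₑ e ⊕ notₑ f)

nonzero-not : ∀ x → nonzero (1 ∸ x) ≡ not (nonzero x)
nonzero-not zero    = refl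
nonzero-not (suc x) = cong nonzero (0∸n≡0 x)

nonzero-+ : ∀ x y → nonzero (x + y) ≡ nonzero x ∨ nonzero y
nonzero-+ zero    y = refl
nonzero-+ (suc x) y = refl

nonzero-and : ∀ x y → nonzero (1 ∸ ((1 ∸ x) + (1 ∸ y))) ≡ nonzero x ∧ nonzero y
nonzero-and zero    y       = cong nonzero (0∸n≡0 (1 ∸ y))
nonzero-and (suc x) zero    = cong (λ z → nonzero (1 ∸ (z + 1))) (0∸n≡0 x)
nonzero-and (suc x) (suc y) = cong₂ (λ z w → nonzero (1 ∸ (z + w))) (0∸n≡0 x) (0∸n≡0 y)

bit-value : ∀ x → 1 ∸ (1 ∸ x) ≡ ⟨ nonzero x ⟩
bit-value zero    = refl
bit-value (suc x) = cong (1 ∸_) (0∸n≡0 x)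

nonzero-⟨⟩ : ∀ b → nonzero ⟨ b ⟩ ≡ b
nonzero-⟨⟩ false = refl
nonzero-⟨⟩ true  = refl

store-eq : ∀ a {i k j} σ → j ≡ i → arr (setArr a i k σ) a j ≡ k
store-eq a {i} σ refl rewrite ≡ᵇ-refl a | ≡ᵇ-refl i = refl

store-neq : ∀ a {i k j} σ → j ≢ i → arr (setArr a i k σ) a j ≡ arr σ a j
store-neq a σ j≢i rewrite ≡ᵇ-refl a | ≢⇒≡ᵇ-false j≢i = refl

<suc-split : ∀ {n} (u v : Fin n) → toℕ u < suc (toℕ v) → toℕ u < toℕ v ⊎ u ≡ v
<suc-split u v (s≤s u≤v) with m≤n⇒m<n∨m≡n u≤v
... | inj₁ u<v = inj₁ u<v
... | inj₂ u≡v = inj₂ (toℕ-injective u≡v)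

pair-injective : ∀ {m} (u v i j : Fin m) → m * toℕ u + toℕ v ≡ m * toℕ i + toℕ j → u ≡ i × v ≡ j
pair-injective u v i j eq = combine-injectiveˡ u v i j eq′ , combine-injectiveʳ u v i j eq′
  where eq′ = toℕ-injective (trans (toℕ-combine u v) (trans eq (sym (toℕ-combine i j))))

next-row : ∀ m i → m * i + m ≡ m * suc i
next-row m i = trans (+-comm (m * i) m) (sym (*-suc m i))

-- Memory layout.  Register 0 and array 0 hold the input, register 1 and array 1
-- the size and the characteristic vector of the best set so far, array 2 the set
-- under examination, array 3 the set B of the second phase; register 2 counts the
-- rounds of the first phase; registers and arrays 8 to 15 are scratch space, and
-- those from 16 on belong to the given programs.  Hypotheses named like 8≡v say
-- that register 8 holds v.
pointwise : ℕ → Expr → Program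
pointwise a e = for 8 0 (a ⟨ var 8 ⟩≔ e)

copy : ℕ → ℕ → Program
copy a b = pointwise b (read a (var 8))

-- Registers 9 and 10 hold the rank of the current vertex and the offset of its
-- row in the adjacency matrix.
members : ℕ → Program
members a = 9 ≔ lit 0 ⨾ 10 ≔ lit 0 ⨾ for 8 0
  ( 11 ≔ bitₑ (read a (var 8))
  ⨾ 8 ⟨ var 9 ⟩≔ var 8 ⨾ 9 ⟨ var 9 ⟩≔ var 10 ⨾ 10 ⟨ var 8 ⟩≔ var 9
  ⨾ 9 ≔ var 9 ⊕ var 11 ⨾ 10 ≔ var 0 ⊕ var 10)

-- Register 11 moves through the new matrix in row-major order, and array 9 supplies the old row
-- offsets, so no product is ever computed.
fillRow : Program
fillRow = for 10 16
  (16 ⟨ var 11 ⟩≔ read 0 (read 9 (var 8) ⊕ read 8 (var 10)) ⨾ 11 ≔ lit 1 ⊕ var 11)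

-- Its target, register and array 16, is where a shifted program finds its register 0 and array 0.
fill : Program
fill = 16 ≔ var 9 ⨾ 11 ≔ lit 0 ⨾ for 8 16 fillRow

sumRow : ℕ → Program
sumRow a =
  for 9 0 (10 ≔ var 10 ⊕ andₑ (read 0 (var 11)) (read a (var 9)) ⨾ 11 ≔ lit 1 ⊕ var 11)

-- Counts for each vertex its neighbours in the set; only whether the count is 0 will matter.
-- Register 11 is the index into the matrix throughout both loops.
neighbours : ℕ → Program
neighbours a = 11 ≔ lit 0 ⨾ for 8 0
  ( 10 ≔ lit 0
  ⨾ sumRow a
  ⨾ 11 ⟨ var 8 ⟩≔ var 10)

record Members {n} (U : Subset n) (σ : State) : Set where
  field
    size    : reg σ 9 ≡ ∣ U ∣
    element : ∀ k → arr σ 8 (toℕ k) ≡ toℕ (enum U k)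
    row     : ∀ k → arr σ 9 (toℕ k) ≡ n * toℕ (enum U k)
    ranks   : ∀ (v : Fin n) → arr σ 10 (toℕ v) ≡ rank U (toℕ v)

-- `C` is the open neighbourhood of `U`; it may meet `U`, and does so exactly at the ends of edges
-- inside `U`.
record Neighbourhood (G : Graph) (U C : VertexSet G) : Set where
  field
    sound    : ∀ {v} → lookup C v ≡ false → NonAdjacent G U v
    complete : ∀ {v} → NonAdjacent G U v → lookup C v ≡ false

-- Verification of the vertex loops

module Verified (G : Graph) (T : ℕ) (1≤T : 1 ≤ T) where

  n : ℕ
  n = order G

  open Timed n T 1≤T public

  n≤N : n ≤ N
  n≤N = m≤n⊔m 2 n

  pointwise-runs : ∀ a e {σ} (U : VertexSet G) → reg σ 0 ≡ n → {_ : IsTrue (cost e <ᵇ 63)} →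
    (∀ v {τ} → Frame (pointwise a e) σ τ → reg τ 8 ≡ toℕ v → nonzero (⟦ e ⟧ τ) ≡ lookup U v) →
    Runs 29 (pointwise a e) σ (λ τ → chars (arr τ a) ≡ U)
  pointwise-runs a e {σ} U 0≡n {cheap} value = weaken ≤-refl (λ {τ} → finish {τ})
    (for-rule I n n≤N 0≡n refl refl (λ _ ()) λ v τ f 8≡v Iv → straight ⇓arr {cheap} (next v τ f 8≡v Iv))
    where
    I : ℕ → State → Set
    I i τ = ∀ v → toℕ v < i → nonzero (arr τ a (toℕ v)) ≡ lookup U v
    finish : ∀ {τ} → I n τ → chars (arr τ a) ≡ U
    finish In = trans (tabulate-cong (λ v → In v (toℕ<n v))) (tabulate∘lookup U)
    next : ∀ v τ → Frame (pointwise a e) σ τ → reg τ 8 ≡ toℕ v → I (toℕ v) τ →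
           I (suc (toℕ v)) (setArr a (reg τ 8) (⟦ e ⟧ τ) τ)
    next v τ f 8≡v Iv u u≤v with <suc-split u v u≤v
    ... | inj₁ u<v = trans (cong nonzero (store-neq a τ (λ u≡8 → <⇒≢ u<v (trans u≡8 8≡v)))) (Iv u u<v)
    ... | inj₂ refl = trans (cong nonzero (store-eq a τ (sym 8≡v))) (value v f 8≡v)

  copy-runs : ∀ a b {σ} → keepsArr a (copy a b) ≡ true → reg σ 0 ≡ n →
              Runs 29 (copy a b) σ (λ τ → chars {n} (arr τ b) ≡ chars (arr σ a))
  copy-runs a b {σ} kept 0≡n = pointwise-runs b _ (chars (arr σ a)) 0≡n λ v {τ} f 8≡v →
    trans (cong₂ (λ g i → nonzero (g i)) (keepArr f a kept) 8≡v) (sym (lookup-chars (arr σ a) v))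

  clear-runs : ∀ a {σ} → reg σ 0 ≡ n → Runs 29 (pointwise a (lit 0)) σ (λ τ → chars {n} (arr τ a) ≡ ⊥)
  clear-runs a 0≡n = pointwise-runs a (lit 0) ⊥ 0≡n λ v _ _ → sym (lookup-replicate v outside)

  members-runs : ∀ a {σ} → keepsArr a (members a) ≡ true → reg σ 0 ≡ n →
                 Runs 43 (members a) σ (Members {n} (chars (arr σ a)))
  members-runs a {σ} kept 0≡n =
    seq-rule assign λ { f₁ refl →
    seq-rule assign λ { f₂ refl →
    weaken ≤-refl (λ {τ} → finish {τ})
      (for-rule I n n≤N 0≡n refl refl
        (sym (rank-zero U) , sym (*-zeroʳ n) , (λ _ ()) , (λ _ ()))
        λ v τ f 8≡v Iv →
          straight (⇓seq ⇓reg (⇓seq ⇓arr (⇓seq ⇓arr (⇓seq ⇓arr (⇓seq ⇓reg ⇓reg)))))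
                   (next v τ (frame-⨾ f₁ (frame-⨾ f₂ f)) 8≡v Iv)) } }
    where
    U = chars {n} (arr σ a)
    -- Every vertex is stored at the next free position, which only advances past members. Arrays 8
    -- and 9 are therefore described just at the positions of members already passed; what lies
    -- beyond is arbitrary.
    I : ℕ → State → Set
    I i τ = reg τ 9 ≡ rank U i
          × reg τ 10 ≡ n * i
          × (∀ k → toℕ (enum U k) < i → arr τ 8 (toℕ k) ≡ toℕ (enum U k) × arr τ 9 (toℕ k) ≡ n * toℕ (enum U k))
          × (∀ (v : Fin n) → toℕ v < i → arr τ 10 (toℕ v) ≡ rank U (toℕ v))
    finish : ∀ {τ} → I n τ → Members U τ
    finish (p , q , es , rs) = record
      { size    = trans p (rank-end U)
      ; element = λ k → proj₁ (es k (toℕ<n _))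
      ; row     = λ k → proj₂ (es k (toℕ<n _))
      ; ranks   = λ v → rs v (toℕ<n v)
      }
    next : ∀ v τ → Frame (members a) σ τ → reg τ 8 ≡ toℕ v → I (toℕ v) τ → I (suc (toℕ v)) record
      { reg = λ x → if x ≡ᵇ 9 then reg τ 9 + (1 ∸ (1 ∸ arr τ a (reg τ 8)))
                    else (if x ≡ᵇ 10 then reg τ 0 + reg τ 10 else reg τ x)
      ; arr = arr (setArr 10 (reg τ 8) (reg τ 9) (setArr 9 (reg τ 9) (reg τ 10)
                  (setArr 8 (reg τ 9) (reg τ 8) τ))) }
    next v τ f 8≡v (p , q , es , rs) =
        (begin
          reg τ 9 + (1 ∸ (1 ∸ arr τ a (reg τ 8)))       ≡⟨ cong₂ _+_ p (bit-value (arr τ a (reg τ 8))) ⟩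
          rank U (toℕ v) + ⟨ nonzero (arr τ a (reg τ 8)) ⟩
            ≡⟨ cong (λ b → rank U (toℕ v) + ⟨ b ⟩) (trans (cong₂ (λ g i → nonzero (g i)) (keepArr f a kept) 8≡v)
                                                          (sym (lookup-chars (arr σ a) v))) ⟩
          rank U (toℕ v) + ⟨ lookup U v ⟩               ≡⟨ rank-suc U v ⟨
          rank U (suc (toℕ v))                          ∎)
      , trans (cong₂ _+_ (trans (keepReg f 0 refl) 0≡n) q) (sym (*-suc n (toℕ v)))
      , entries
      , ranks
      where
      open ≡-Reasoning
      entries : ∀ k → toℕ (enum U k) < suc (toℕ v) →
                arr (setArr 8 (reg τ 9) (reg τ 8) τ) 8 (toℕ k) ≡ toℕ (enum U k)
              × arr (setArr 9 (reg τ 9) (reg τ 10) τ) 9 (toℕ k) ≡ n * toℕ (enum U k)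
      entries k k≤v with <suc-split (enum U k) v k≤v
      ... | inj₁ k<v = trans (store-neq 8 τ k≢p) (proj₁ (es k k<v))
                     , trans (store-neq 9 τ k≢p) (proj₂ (es k k<v))
        where
        k≢p : toℕ k ≢ reg τ 9
        -- Members passed earlier have smaller ranks, so the write at register 9 spares their
        -- entries.
        k≢p k≡p = <⇒≢ (rank-enum-< U k k<v) (trans k≡p p)
      ... | inj₂ refl = trans (store-eq 8 τ k≡p) 8≡v , trans (store-eq 9 τ k≡p) q
        where
        k≡p : toℕ k ≡ reg τ 9
        k≡p = trans (sym (rank-enum U k)) (sym p)
      ranks : ∀ (u : Fin n) → toℕ u < suc (toℕ v) →
              arr (setArr 10 (reg τ 8) (reg τ 9) τ) 10 (toℕ u) ≡ rank U (toℕ u)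
      ranks u u≤v with <suc-split u v u≤v
      ... | inj₁ u<v = trans (store-neq 10 τ (λ u≡8 → <⇒≢ u<v (trans u≡8 8≡v))) (rs u u<v)
      ... | inj₂ refl = trans (store-eq 10 τ (sym 8≡v)) p

  ≤n⇒≤N : ∀ (U : VertexSet G) → ∣ U ∣ ≤ N
  ≤n⇒≤N U = ≤-trans (∣p∣≤n U) n≤N

  fill-runs : ∀ {U σ} → Input G σ → Members U σ → Runs 66 fill σ (λ τ → Input (G [ U ]) (upper τ))
  fill-runs {U} {σ} input mem =
    seq-rule assign λ { f₁ refl →
    seq-rule assign λ { f₂ refl →
    weaken ≤-refl (λ {τ} → finish {τ})
      (for-rule I w (≤n⇒≤N U) (Members.size mem) refl refl
        ((Members.size mem , sym (*-zeroʳ w)) ,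
         λ u v q< → contradiction (subst (w * toℕ u + toℕ v <_) (*-zeroʳ w) q<) λ ())
        λ i τ f 8≡i ((16≡size , 11≡q) , filled) →
          weaken ≤-refl (λ {υ} → next-I i υ)
            (for-rule (J i) w (≤n⇒≤N U) 16≡size refl refl
              ((8≡i , 16≡size , trans 11≡q (sym (+-identityʳ _))) ,
               λ u v q< → filled u v (subst (w * toℕ u + toℕ v <_) (+-identityʳ _) q<))
              λ j υ g 10≡j Jj →
                straight (⇓seq ⇓arr ⇓reg)
                  (next i j υ (frame-⨾ f₁ (frame-⨾ f₂ f)) g 10≡j Jj))) } }
    where
    open Members mem
    w = ∣ U ∣
    -- Counting entries in row-major order makes the end of one row and the start of the next the
    -- same condition.
    Filled : ℕ → State → Set
    Filled q τ = ∀ (u v : Fin w) → w * toℕ u + toℕ v < q →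
                 arr τ 16 (w * toℕ u + toℕ v) ≡ ⟨ adj G (enum U u) (enum U v) ⟩
    I : ℕ → State → Set
    I i τ = (reg τ 16 ≡ w × reg τ 11 ≡ w * i) × Filled (w * i) τ
    J : Fin w → ℕ → State → Set
    J i j τ = (reg τ 8 ≡ toℕ i × reg τ 16 ≡ w × reg τ 11 ≡ w * toℕ i + j) × Filled (w * toℕ i + j) τ
    finish : ∀ {τ} → I w τ → Input (G [ U ]) (upper τ)
    finish ((16≡size , _) , filled) = record
      { size   = 16≡size
      ; matrix = λ u v → filled u v (subst (_< w * w) (toℕ-combine u v) (toℕ<n (combine u v)))
      }
    next-I : ∀ i τ → J i w τ → I (suc (toℕ i)) (setReg 8 (suc (toℕ i)) τ)
    next-I i τ ((_ , 16≡size , 11≡q) , filled) =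
      (16≡size , trans 11≡q (next-row w (toℕ i))) , subst (λ q → Filled q τ) (next-row w (toℕ i)) filled
    next : ∀ i j {τ} υ → Frame fill σ τ → Frame fillRow τ υ → reg υ 10 ≡ toℕ j → J i (toℕ j) υ →
           J i (suc (toℕ j)) (setReg 11 (suc (reg υ 11))
             (setArr 16 (reg υ 11) (arr υ 0 (arr υ 9 (reg υ 8) + arr υ 8 (reg υ 10))) υ))
    next i j υ f g 10≡j ((8≡i , 16≡size , 11≡q) , filled) =
      (8≡i , 16≡size , trans (cong suc 11≡q) (sym (+-suc _ _))) , filled′
      where
      open ≡-Reasoning
      q = w * toℕ i + toℕ j
      kept : ∀ a → keepsArr a fill ≡ true → keepsArr a fillRow ≡ true → arr υ a ≡ arr σ a
      kept a k l = trans (keepArr g a l) (keepArr f a k)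
      value : arr υ 0 (arr υ 9 (reg υ 8) + arr υ 8 (reg υ 10)) ≡ ⟨ adj G (enum U i) (enum U j) ⟩
      value = begin
        arr υ 0 (arr υ 9 (reg υ 8) + arr υ 8 (reg υ 10))
          ≡⟨ cong₂ (λ x y → arr υ 0 (arr υ 9 x + arr υ 8 y)) 8≡i 10≡j ⟩
        arr υ 0 (arr υ 9 (toℕ i) + arr υ 8 (toℕ j))
          ≡⟨ cong₂ (λ x y → arr υ 0 (x (toℕ i) + y (toℕ j))) (kept 9 refl refl) (kept 8 refl refl) ⟩
        arr υ 0 (arr σ 9 (toℕ i) + arr σ 8 (toℕ j))
          ≡⟨ cong₂ (λ x y → arr υ 0 (x + y)) (row i) (element j) ⟩
        arr υ 0 (n * toℕ (enum U i) + toℕ (enum U j))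
          ≡⟨ cong (λ A → A (n * toℕ (enum U i) + toℕ (enum U j))) (kept 0 refl refl) ⟩
        arr σ 0 (n * toℕ (enum U i) + toℕ (enum U j))
          ≡⟨ Input.matrix input (enum U i) (enum U j) ⟩
        ⟨ adj G (enum U i) (enum U j) ⟩ ∎
      filled′ : Filled (w * toℕ i + suc (toℕ j)) (setArr 16 (reg υ 11) _ υ)
      filled′ u v q< with m≤n⇒m<n∨m≡n (≤-pred (subst (w * toℕ u + toℕ v <_) (+-suc (w * toℕ i) (toℕ j)) q<))
      ... | inj₁ old = trans (store-neq 16 υ (λ eq → <⇒≢ old (trans eq 11≡q))) (filled u v old)
      ... | inj₂ new with refl , refl ← pair-injective u v i j new =
        trans (store-eq 16 υ (sym 11≡q)) value

  neighbours-runs : ∀ a {σ} → keepsArr a (neighbours a) ≡ true → Input G σ →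
    Runs 73 (neighbours a) σ (λ τ → Neighbourhood G (chars (arr σ a)) (chars (arr τ 11)))
  neighbours-runs a {σ} kept-a input =
    seq-rule assign λ { f₁ refl →
    weaken ≤-refl (λ {τ} → finish {τ})
      (for-rule I n n≤N (Input.size input) refl refl
        (sym (*-zeroʳ n) , λ _ ())
        λ v τ f 8≡v (11≡q , rows) →
          seq-rule assign λ { f₂ refl →
          seq-rule
            (for-rule (J v) n n≤N (trans (keepReg f 0 refl) (Input.size input)) refl refl
              (trans 11≡q (sym (+-identityʳ _)) , (λ _ _ ()) , λ _ → refl)
              λ u υ g 9≡u Ju → straight (⇓seq ⇓reg ⇓reg)
                (next-J v u υ (frame-⨾ f₁ f) (frame-⨾ f₂ g) 9≡u Ju))
            λ {υ} g Jn → straight ⇓arr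
              (next-I v τ υ 8≡v (11≡q , rows) (frame-⨾ f₂ g) Jn) }) }
    where
    U = chars {n} (arr σ a)
    NonAdjacentBelow : Fin n → ℕ → Set
    NonAdjacentBelow v j = ∀ u → toℕ u < j → u ∈ U → adj G v u ≡ false
    I : ℕ → State → Set
    I i τ = reg τ 11 ≡ n * i × (∀ v → toℕ v < i →
      (nonzero (arr τ 11 (toℕ v)) ≡ false → NonAdjacent G U v) ×
      (NonAdjacent G U v → nonzero (arr τ 11 (toℕ v)) ≡ false))
    J : Fin n → ℕ → State → Set
    J v j τ = reg τ 11 ≡ n * toℕ v + j
            × (nonzero (reg τ 10) ≡ false → NonAdjacentBelow v j)
            × (NonAdjacentBelow v j → nonzero (reg τ 10) ≡ false)
    finish : ∀ {τ} → I n τ → Neighbourhood G U (chars (arr τ 11))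
    finish {τ} (_ , rows) = record
      { sound    = λ {v} eq → proj₁ (rows v (toℕ<n v)) (trans (sym (lookup-chars (arr τ 11) v)) eq)
      ; complete = λ {v} nonadj → trans (lookup-chars (arr τ 11) v) (proj₂ (rows v (toℕ<n v)) nonadj)
      }
    next-J : ∀ v u {τ} υ → Frame (neighbours a) σ τ → Frame (10 ≔ lit 0 ⨾ sumRow a) τ υ →
             reg υ 9 ≡ toℕ u → J v (toℕ u) υ →
             J v (suc (toℕ u)) (setReg 11 (suc (reg υ 11)) (setReg 10 (reg υ 10 +
               (1 ∸ ((1 ∸ arr υ 0 (reg υ 11)) + (1 ∸ arr υ a (reg υ 9))))) υ))
    next-J v u υ f g 9≡u (11≡q , sound , complete) =
      trans (cong suc 11≡q) (sym (+-suc _ _)) ,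
      (λ eq w w≤u w∈ → sound′ w w≤u w∈ (∨-false (trans (sym old-or-new) eq))) ,
      (λ nonadj → trans old-or-new (cong₂ _∨_
        (complete (λ w w<u → nonadj w (m≤n⇒m≤1+n w<u)))
        (current-false nonadj)))
      where
      open ≡-Reasoning
      current : Bool
      current = adj G v u ∧ lookup U u
      kept : ∀ b → keepsArr b (neighbours a) ≡ true → keepsArr b (10 ≔ lit 0 ⨾ sumRow a) ≡ true →
             arr υ b ≡ arr σ b
      kept b k l = trans (keepArr g b l) (keepArr f b k)
      A≡ : nonzero (arr υ 0 (reg υ 11)) ≡ adj G v u
      A≡ = begin
        nonzero (arr υ 0 (reg υ 11))                 ≡⟨ cong₂ (λ A q → nonzero (A q)) (kept 0 refl refl) 11≡q ⟩
        nonzero (arr σ 0 (n * toℕ v + toℕ u))        ≡⟨ cong nonzero (Input.matrix input v u) ⟩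
        nonzero ⟨ adj G v u ⟩                        ≡⟨ nonzero-⟨⟩ (adj G v u) ⟩
        adj G v u                                    ∎
      a≡ : nonzero (arr υ a (reg υ 9)) ≡ lookup U u
      a≡ = begin
        nonzero (arr υ a (reg υ 9))  ≡⟨ cong₂ (λ A q → nonzero (A q)) (kept a kept-a refl) 9≡u ⟩
        nonzero (arr σ a (toℕ u))    ≡⟨ lookup-chars (arr σ a) u ⟨
        lookup U u                   ∎
      old-or-new : nonzero (reg υ 10 + (1 ∸ ((1 ∸ arr υ 0 (reg υ 11)) + (1 ∸ arr υ a (reg υ 9)))))
                   ≡ nonzero (reg υ 10) ∨ current
      old-or-new = trans (nonzero-+ (reg υ 10) _) (cong (nonzero (reg υ 10) ∨_)
        (trans (nonzero-and (arr υ 0 (reg υ 11)) (arr υ a (reg υ 9))) (cong₂ _∧_ A≡ a≡)))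
      ∨-false : ∀ {x y} → x ∨ y ≡ false → x ≡ false × y ≡ false
      ∨-false {false} {false} _ = refl , refl
      sound′ : ∀ w → toℕ w < suc (toℕ u) → w ∈ U → nonzero (reg υ 10) ≡ false × current ≡ false →
               adj G v w ≡ false
      sound′ w w≤u w∈ (old , new) with <suc-split w u w≤u
      ... | inj₁ w<u = sound old w w<u w∈
      ... | inj₂ refl = trans (sym (∧-identityʳ _)) (trans (cong (adj G v u ∧_) (sym ([]=⇒lookup w∈))) new)
      current-false : NonAdjacentBelow v (suc (toℕ u)) → current ≡ false
      current-false nonadj with lookup U u in eq
      ... | false = ∧-zeroʳ (adj G v u)
      ... | true  = trans (∧-identityʳ _) (nonadj u ≤-refl (lookup⇒[]= u U eq))
    next-I : ∀ v τ υ → reg τ 8 ≡ toℕ v → I (toℕ v) τ → Frame (10 ≔ lit 0 ⨾ sumRow a) τ υ → J v n υ →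
             I (suc (toℕ v)) (setArr 11 (reg υ 8) (reg υ 10) υ)
    next-I v τ υ 8≡v (_ , rows) g (11≡q , sound , complete) =
      trans 11≡q (next-row n (toℕ v)) , rows′
      where
      8≡v′ : reg υ 8 ≡ toℕ v
      8≡v′ = trans (keepReg g 8 refl) 8≡v
      rows′ : ∀ w → toℕ w < suc (toℕ v) →
        let x = arr (setArr 11 (reg υ 8) (reg υ 10) υ) 11 (toℕ w) in
        (nonzero x ≡ false → NonAdjacent G U w) × (NonAdjacent G U w → nonzero x ≡ false)
      rows′ w w≤v with <suc-split w v w≤v
      ... | inj₁ w<v rewrite store-neq 11 {k = reg υ 10} υ (λ w≡8 → <⇒≢ w<v (trans w≡8 8≡v′))
                       | keepArr g 11 refl =
        rows w w<v
      ... | inj₂ refl rewrite store-eq 11 {k = reg υ 10} υ (sym 8≡v′) =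
        (λ eq {u} u∈ → sound eq u (toℕ<n u) u∈) , λ nonadj → complete (λ u _ u∈ → nonadj u∈)

-- Exhaustive search over few flips

-- An involution on the represented set, so a second call undoes it without a saved copy.
toggle : ℕ → Program
toggle k = 2 ⟨ read 4 (lit k) ⟩≔ notₑ (read 2 (read 4 (lit k)))

-- Array 4 holds one loop counter per nesting level.
enumerate : Program → ℕ → Program
enumerate P zero    = P
enumerate P (suc k) = enumerate P k ⨾ 4 ⟨ lit k ⟩≔ lit 0 ⨾ whilenz (var 0 ⊖ read 4 (lit k))
  (toggle k ⨾ enumerate P k ⨾ toggle k ⨾ 4 ⟨ lit k ⟩≔ lit 1 ⊕ read 4 (lit k))

enumerate-keepsReg : ∀ {x P} k → keepsReg x P ≡ true → keepsReg x (enumerate P k) ≡ true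
enumerate-keepsReg zero    kept = kept
enumerate-keepsReg {x} {P} (suc k) kept rewrite enumerate-keepsReg {x} {P} k kept = refl

flipAt-involutive : ∀ {n} (v : Fin n) U → flipAt v (flipAt v U) ≡ U
flipAt-involutive v U =
  trans (updateAt-updateAt v U) (updateAt-id-local v U (not-involutive (lookup U v)))

chars-toggle : ∀ {n} σ {i} (v : Fin n) → i ≡ toℕ v →
  chars (arr (setArr 2 i (1 ∸ arr σ 2 i) σ) 2) ≡ flipAt v (chars (arr σ 2))
chars-toggle σ {i} v i≡v = trans (tabulate-cong pointwise-equal) (tabulate∘lookup _)
  where
  f = arr σ 2
  pointwise-equal : ∀ u → nonzero (arr (setArr 2 i (1 ∸ f i) σ) 2 (toℕ u)) ≡ lookup (flipAt v (chars f)) u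
  pointwise-equal u with u Fin.≟ v
  ... | yes refl = begin
    nonzero (arr (setArr 2 i (1 ∸ f i) σ) 2 (toℕ u))  ≡⟨ cong nonzero (store-eq 2 σ (sym i≡v)) ⟩
    nonzero (1 ∸ f i)                                 ≡⟨ nonzero-not (f i) ⟩
    not (nonzero (f i))                               ≡⟨ cong (not ∘ nonzero ∘ f) i≡v ⟩
    not (nonzero (f (toℕ u)))                         ≡⟨ cong not (lookup-chars f u) ⟨
    not (lookup (chars f) u)                          ≡⟨ lookup∘updateAt u (chars f) ⟨
    lookup (flipAt u (chars f)) u                     ∎
    where open ≡-Reasoning
  ... | no u≢v = begin
    nonzero (arr (setArr 2 i (1 ∸ f i) σ) 2 (toℕ u))
      ≡⟨ cong nonzero (store-neq 2 σ (λ u≡i → u≢v (toℕ-injective (trans u≡i i≡v)))) ⟩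
    nonzero (f (toℕ u))                               ≡⟨ lookup-chars f u ⟨
    lookup (chars f) u                                ≡⟨ lookup∘updateAt′ u v u≢v (chars f) ⟨
    lookup (flipAt v (chars f)) u                     ∎
    where open ≡-Reasoning

improve : ℕ → Program
improve a = ifnz (var 9 ⊖ var 1) (1 ≔ var 9 ⨾ copy a 1) skip

-- Enumeration that maintains a best set

module Optimisation (G : Graph) (T : ℕ) (1≤T : 1 ≤ T) where

  open Verified G T 1≤T public

  -- `Good` is sparseness in the first phase and independence in the second, so that both searches
  -- share one enumeration.
  record Incumbent (Good : VertexSet G → Set ℓ) (B : VertexSet G) (σ : State) : Set ℓ where
    field
      input : Input G σ
      base  : chars (arr σ 3) ≡ B
      good  : Good (chars (arr σ 1))
      size  : reg σ 1 ≡ ∣ chars {n} (arr σ 1) ∣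

    0≡n : reg σ 0 ≡ n
    0≡n = Input.size input

  Input-cong : ∀ {σ τ} → reg τ 0 ≡ reg σ 0 → arr τ 0 ≡ arr σ 0 → Input G σ → Input G τ
  Input-cong r a input = record
    { size   = trans r (Input.size input)
    ; matrix = λ u v → trans (cong (λ A → A _) a) (Input.matrix input u v)
    }

  Incumbent-cong : ∀ {Good : VertexSet G → Set ℓ} {B σ τ} → reg τ 0 ≡ reg σ 0 → reg τ 1 ≡ reg σ 1 →
    arr τ 0 ≡ arr σ 0 → arr τ 1 ≡ arr σ 1 → arr τ 3 ≡ arr σ 3 → Incumbent Good B σ → Incumbent Good B τ
  Incumbent-cong {Good = Good} r₀ r₁ a₀ a₁ a₃ inc = record
    { input = Input-cong r₀ a₀ input
    ; base  = trans (cong chars a₃) base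
    ; good  = subst (Good ∘ chars) (sym a₁) good
    ; size  = trans r₁ (trans size (cong (∣_∣ ∘ chars {n}) (sym a₁)))
    }
    where open Incumbent inc

  -- `Claim Y w` is what the test of `Y` owes: afterwards the best size must be at least `w`.
  module Enumeration (Good : VertexSet G → Set ℓ) (B : VertexSet G) (Claim : VertexSet G → ℕ → Set ℓ′) where

    -- Depth `k` touches only counters below `k` and restores the set under examination, so the
    -- loops around it can continue.
    record Explored (k : ℕ) (σ τ : State) : Set (ℓ Level.⊔ ℓ′) where
      field
        incumbent : Incumbent Good B τ
        current   : chars {n} (arr τ 2) ≡ chars (arr σ 2)
        counters  : ∀ j → k ≤ j → arr τ 4 j ≡ arr σ 4 j
        improved  : reg σ 1 ≤ reg τ 1
        optimal   : ∀ {Y w} → Flips k (chars (arr σ 2)) Y → Claim Y w → w ≤ reg τ 1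

    module _ {P e} (P-runs : ∀ {σ} → Incumbent Good B σ → Runs e P σ (Explored 0 σ)) where

      -- Each level adds `14 = 3 + 9 + 2`: sequencing in the body, the loop, and sequencing around
      -- it. The `6` leaves room for loop-free code already at depth 0.
      enumerate-runs : ∀ k {σ} → Incumbent Good B σ →
                       Runs (k * 14 + (6 + e)) (enumerate P k) σ (Explored k σ)
      enumerate-runs zero    inc = weaken (m≤n+m e 6) id (P-runs inc)
      enumerate-runs (suc k) {σ} inc =
        seq-rule-⊔ (weaken (m≤n+m _ 13) id (enumerate-runs k inc)) λ {σ₁} _ ex₁ →
        seq-rule-⊔ (weaken (m≤n⇒m≤o+n 12 cheap) id
          (straight {Q = I σ₁ 0} ⇓arr (start σ₁ ex₁))) λ _ start →
        weaken ≤-refl (finish σ₁ ex₁)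
          (while-rule {e = 3 + f} (I σ₁) n n≤N (≤ᵇ⇒≤ 4 63 _) (enter {σ₁}) (exit {σ₁}) (iterate {σ₁}) start)
        where
        f = k * 14 + (6 + e)
        cheap : 6 ≤ f
        cheap = m≤n⇒m≤o+n (k * 14) (m≤m+n 6 e)
        I : State → ℕ → State → Set _
        I σ₁ i τ = Incumbent Good B τ × chars (arr τ 2) ≡ U
                × arr τ 4 k ≡ i × (∀ j → k < j → arr τ 4 j ≡ arr σ₁ 4 j) × reg σ₁ 1 ≤ reg τ 1
                × (∀ v → toℕ v < i → ∀ {Y w} → Flips k (flipAt v U) Y → Claim Y w → w ≤ reg τ 1)
          where U = chars {n} (arr σ₁ 2)
        enter : ∀ {σ₁ i τ} → I σ₁ i τ → i < n → reg τ 0 ∸ arr τ 4 k ≢ 0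
        enter (inc , _ , refl , _) i<n eq =
          <⇒≱ i<n (≤-trans (≤-reflexive (sym (Incumbent.0≡n inc))) (m∸n≡0⇒m≤n eq))
        exit : ∀ {σ₁ τ} → I σ₁ n τ → reg τ 0 ∸ arr τ 4 k ≡ 0
        exit (inc , _ , c≡n , _) = m≤n⇒m∸n≡0 (≤-reflexive (trans (Incumbent.0≡n inc) (sym c≡n)))
        iterate : ∀ {σ₁} (v : Fin n) τ → I σ₁ (toℕ v) τ →
          Runs (3 + f) (toggle k ⨾ enumerate P k ⨾ toggle k ⨾ 4 ⟨ lit k ⟩≔ lit 1 ⊕ read 4 (lit k)) τ
               (I σ₁ (suc (toℕ v)))
        iterate {σ₁} v τ (inc , cur , c≡v , cnt , imp , opt) =
          seq-rule-⊔ (weaken (m≤n⇒m≤o+n 2 cheap) id (straight {Q = _≡ τ₁} ⇓arr refl)) λ { _ refl →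
          seq-rule-⊔ (weaken (n≤1+n f) id
            (enumerate-runs k (Incumbent-cong refl refl refl refl refl inc))) λ {τ₂} _ ex →
          weaken (s≤s cheap) id (seq-rule-⊔
            (straight {Q = _≡ setArr 2 (arr τ₂ 4 k) (1 ∸ arr τ₂ 2 (arr τ₂ 4 k)) τ₂} ⇓arr refl) λ { _ refl →
          straight ⇓arr (next τ₂ ex) }) }
          where
          U = chars {n} (arr σ₁ 2)
          τ₁ = setArr 2 (arr τ 4 k) (1 ∸ arr τ 2 (arr τ 4 k)) τ
          flipped : chars (arr τ₁ 2) ≡ flipAt v U
          flipped = trans (chars-toggle τ v c≡v) (cong (flipAt v) cur)
          next : ∀ τ₂ → Explored k τ₁ τ₂ →
                 let τ₃ = setArr 2 (arr τ₂ 4 k) (1 ∸ arr τ₂ 2 (arr τ₂ 4 k)) τ₂ in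
                 I σ₁ (suc (toℕ v)) (setArr 4 k (suc (arr τ₃ 4 k)) τ₃)
          next τ₂ ex =
              Incumbent-cong refl refl refl refl refl incumbent
            , (begin
                chars (arr τ₃ 2)                   ≡⟨ chars-toggle τ₂ v c≡v′ ⟩
                flipAt v (chars (arr τ₂ 2))        ≡⟨ cong (flipAt v) (trans current flipped) ⟩
                flipAt v (flipAt v U)              ≡⟨ flipAt-involutive v U ⟩
                U                                  ∎)
            , trans (store-eq 4 {k} τ₃ refl) (cong suc c≡v′)
            , (λ j k<j → trans (store-neq 4 τ₃ (>⇒≢ k<j)) (trans (counters j (<⇒≤ k<j)) (cnt j k<j)))
            , ≤-trans imp improved
            , best
            where
            open Explored ex
            open ≡-Reasoning
            τ₃ = setArr 2 (arr τ₂ 4 k) (1 ∸ arr τ₂ 2 (arr τ₂ 4 k)) τ₂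
            c≡v′ : arr τ₂ 4 k ≡ toℕ v
            c≡v′ = trans (counters k ≤-refl) c≡v
            best : ∀ u → toℕ u < suc (toℕ v) → ∀ {Y w} → Flips k (flipAt u U) Y → Claim Y w → w ≤ reg τ₂ 1
            best u u≤v fl c with <suc-split u v u≤v
            ... | inj₁ u<v  = ≤-trans (opt u u<v fl c) improved
            ... | inj₂ refl = optimal (subst (λ X → Flips k X _) (sym flipped) fl) c
        start : ∀ σ₁ → Explored k σ σ₁ → I σ₁ 0 (setArr 4 k 0 σ₁)
        start σ₁ ex = Incumbent-cong refl refl refl refl refl (Explored.incumbent ex) , refl
                    , store-eq 4 σ₁ refl , (λ j k<j → store-neq 4 σ₁ (>⇒≢ k<j)) , ≤-refl , λ _ ()
        finish : ∀ σ₁ → Explored k σ σ₁ → ∀ {τ} → I σ₁ n τ → Explored (suc k) σ τ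
        finish σ₁ ex (inc , cur , _ , cnt , imp , opt) = record
          { incumbent = inc
          ; current   = trans cur current
          ; counters  = λ j k<j → trans (cnt j k<j) (counters j (<⇒≤ k<j))
          ; improved  = ≤-trans improved imp
          ; optimal   = λ { done c → ≤-trans (optimal done c) imp
                          ; (step v fl) c → opt v (toℕ<n v)
                              (subst (λ U → Flips k (flipAt v U) _) (sym current) fl) c }
          }
          where open Explored ex

-- Testing one candidate set

test : Program → Program
test R = members 2 ⨾ fill ⨾ shift R ⨾ ifnz (var 16) (improve 2) skip

-- Membership in `B` but neither in `X` nor among its neighbours: arrays 3, 2 and 11 hold `B`, `X`
-- and these neighbours.
unreached : Expr
unreached = andₑ (read 3 (var 8)) (notₑ (read 2 (var 8) ⊕ read 11 (var 8)))

-- Array 16 holds the answer of `M` by position in `Y`, so it is read at the rank found in array 10;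
-- array 12 masks the vertices outside `Y`.
joined : Expr
joined = read 2 (var 8) ⊕ andₑ (read 12 (var 8)) (read 16 (read 10 (var 8)))

conflict : Expr
conflict = andₑ (read 13 (var 8)) (read 11 (var 8))

extend : Program → Program
extend M = neighbours 2 ⨾ pointwise 12 unreached ⨾ members 12 ⨾ fill ⨾ shift M ⨾ pointwise 13 joined

-- `X` may contain edges, and then so does the union. A set is independent if and only if it misses
-- its own neighbourhood; `members 14` leaves the number of conflicts in register 9.
keepIfIndependent : Program
keepIfIndependent = neighbours 13 ⨾ pointwise 14 conflict ⨾ members 14 ⨾
  ifnz (var 9) skip (members 13 ⨾ improve 13)

-- Within a round the flips start from the set copied at its beginning, although the best set may
-- already have grown. Array 3 saves the result of the first phase before array 1 is reused.
search : ℕ → ℕ → Program → Program → Program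
search k l R M =
    pointwise 1 (lit 0) ⨾ 1 ≔ lit 0 ⨾ for 2 0 (copy 1 2 ⨾ enumerate (test R) k)
  ⨾ copy 1 3 ⨾ pointwise 1 (lit 0) ⨾ 1 ≔ lit 0 ⨾ pointwise 2 (lit 0)
  ⨾ enumerate (extend M ⨾ keepIfIndependent) l ⨾ copy 1 0

-- `keepsReg` does not compute on `test R` for a variable `R`; with `skip` in its place it does.
test-keepsReg : ∀ R {x} → x < 16 → keepsReg x (test skip) ≡ true → keepsReg x (test R) ≡ true
test-keepsReg R {x} x<16 kept rewrite shift-keepsReg R x<16 = kept

keepsCore : Program → Bool
keepsCore P = (keepsReg 0 P ∧ keepsReg 1 P)
            ∧ keepsArr 0 P ∧ keepsArr 1 P ∧ keepsArr 2 P ∧ keepsArr 3 P ∧ keepsArr 4 P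

-- The memory whose content has to outlive the work on one candidate; only `improve` may then change
-- it.
record SameCore (σ τ : State) : Set where
  field
    reg0 : reg τ 0 ≡ reg σ 0
    reg1 : reg τ 1 ≡ reg σ 1
    arr0 : arr τ 0 ≡ arr σ 0
    arr1 : arr τ 1 ≡ arr σ 1
    arr2 : arr τ 2 ≡ arr σ 2
    arr3 : arr τ 3 ≡ arr σ 3
    arr4 : arr τ 4 ≡ arr σ 4

core-trans : ∀ {σ τ υ} → SameCore σ τ → SameCore τ υ → SameCore σ υ
core-trans c d = record
  { reg0 = trans (reg0 d) (reg0 c)
  ; reg1 = trans (reg1 d) (reg1 c)
  ; arr0 = trans (arr0 d) (arr0 c)
  ; arr1 = trans (arr1 d) (arr1 c)
  ; arr2 = trans (arr2 d) (arr2 c)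
  ; arr3 = trans (arr3 d) (arr3 c)
  ; arr4 = trans (arr4 d) (arr4 c)
  }
  where open SameCore

core-frame : ∀ {P σ τ} → keepsCore P ≡ true → Frame P σ τ → SameCore σ τ
core-frame {P} kept f
  with keepsReg 0 P in r₀ | keepsReg 1 P in r₁
     | keepsArr 0 P in a₀ | keepsArr 1 P in a₁ | keepsArr 2 P in a₂ | keepsArr 3 P in a₃ | keepsArr 4 P in a₄
core-frame refl f | true | true | true | true | true | true | true = record
  { reg0 = keepReg f 0 r₀
  ; reg1 = keepReg f 1 r₁
  ; arr0 = keepArr f 0 a₀
  ; arr1 = keepArr f 1 a₁
  ; arr2 = keepArr f 2 a₂
  ; arr3 = keepArr f 3 a₃
  ; arr4 = keepArr f 4 a₄
  }

shift-core : ∀ P {σ τ} → Frame (shift P) σ τ → SameCore σ τ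
shift-core P = core-frame (cong₂ _∧_ (cong₂ _∧_ (r (s≤s z≤n)) (r (s≤s (s≤s z≤n))))
  (cong₂ _∧_ (a 0) (cong₂ _∧_ (a 1) (cong₂ _∧_ (a 2) (cong₂ _∧_ (a 3) (a 4))))))
  where
  r : ∀ {x} → x < 16 → keepsReg x (shift P) ≡ true
  r = shift-keepsReg P
  a : ∀ x → {_ : IsTrue (x <ᵇ 16)} → keepsArr x (shift P) ≡ true
  a x {x<16} = shift-keepsArr P (<ᵇ⇒< x 16 x<16)

∈⇒∣p∣≢0 : ∀ {n} {p : Subset n} {v} → v ∈ p → ∣ p ∣ ≢ 0
∈⇒∣p∣≢0 {p = outside ∷ p} (there v∈) eq = ∈⇒∣p∣≢0 v∈ eq

empty⇒∣p∣≡0 : ∀ {n} {p : Subset n} → Empty p → ∣ p ∣ ≡ 0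
empty⇒∣p∣≡0 {n} empty = trans (cong ∣_∣ (Empty-unique empty)) (∣⊥∣≡0 n)

∉⇒lookup≡false : ∀ {n} {p : Subset n} {v} → v ∉ p → lookup p v ≡ false
∉⇒lookup≡false {p = p} {v} v∉p = ¬-not (v∉p ∘ lookup⇒[]= v p)

lookup≡false⇒∉ : ∀ {n} {p : Subset n} {v} → lookup p v ≡ false → v ∉ p
lookup≡false⇒∉ eq v∈p with () ← trans (sym eq) ([]=⇒lookup v∈p)

-- The test of one candidate in each phase

module Phases (G : Graph) (T : ℕ) (1≤T : 1 ≤ T) where

  open Optimisation G T 1≤T public

  Incumbent-core : ∀ {Good : VertexSet G → Set ℓ} {B σ τ} → SameCore σ τ →
                   Incumbent Good B σ → Incumbent Good B τ
  Incumbent-core c = Incumbent-cong reg0 reg1 arr0 arr1 arr3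
    where open SameCore c

  record Improved (Good : VertexSet G → Set ℓ) (B : VertexSet G) (σ τ : State) : Set ℓ where
    field
      incumbent : Incumbent Good B τ
      current   : arr τ 2 ≡ arr σ 2
      counters  : arr τ 4 ≡ arr σ 4
      improved  : reg σ 1 ≤ reg τ 1
      candidate : reg σ 9 ≤ reg τ 1

  improve-runs : ∀ {Good : VertexSet G → Set ℓ} {B} a {σ} → keepsArr a (copy a 1) ≡ true → Incumbent Good B σ →
    Good (chars (arr σ a)) → reg σ 9 ≡ ∣ chars {n} (arr σ a) ∣ →
    Runs 43 (improve a) σ (Improved Good B σ)
  improve-runs {Good = Good} a {σ} kept inc good-a size-a = if-rule (≤ᵇ⇒≤ 3 63 _)
    (λ 9∸1≢0 → let 1<9 = m∸n≢0⇒n<m 9∸1≢0 in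
      seq-rule assign λ { f refl →
      weaken ≤-refl (λ { (g , copied) → record
        { incumbent = record
            { input = Input-cong (keepReg (frame-⨾ f g) 0 refl) (keepArr (frame-⨾ f g) 0 refl) input
            ; base  = trans (cong chars (keepArr (frame-⨾ f g) 3 refl)) base
            ; good  = subst Good (sym copied) good-a
            ; size  = trans (keepReg g 1 refl) (trans size-a (cong ∣_∣ (sym copied)))
            }
        ; current   = keepArr (frame-⨾ f g) 2 refl
        ; counters  = keepArr (frame-⨾ f g) 4 refl
        ; improved  = ≤-trans (<⇒≤ 1<9) (≤-reflexive (sym (keepReg g 1 refl)))
        ; candidate = ≤-reflexive (sym (keepReg g 1 refl))
        } }) (framed (copy-runs a 1 kept 0≡n)) })
    (λ 9∸1≡0 → weaken (m≤n+m 6 30) id (straight ⇓skip (record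
      { incumbent = inc ; current = refl ; counters = refl ; improved = ≤-refl
      ; candidate = m∸n≡0⇒m≤n 9∸1≡0 })))
    where open Incumbent inc

  module _ {Good : VertexSet G → Set ℓ} {B : VertexSet G} {Claim : VertexSet G → ℕ → Set ℓ′} where

    open Enumeration Good B Claim

    explored : ∀ {σ τ υ} → SameCore σ τ → Improved Good B τ υ →
               (∀ {w} → Claim (chars (arr σ 2)) w → w ≤ reg υ 1) → Explored 0 σ υ
    explored c imp best = record
      { incumbent = incumbent
      ; current   = cong chars (trans current arr2)
      ; counters  = λ j _ → cong (λ A → A j) (trans counters arr4)
      ; improved  = ≤-trans (≤-reflexive (sym reg1)) improved
      ; optimal   = λ { done → best }
      }
      where
      open Improved imp
      open SameCore c

    -- For rejected candidates, which may be dropped because no claim rests on them.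
    unchanged : ∀ {σ τ} → SameCore σ τ → Incumbent Good B σ →
                (∀ {w} → ¬ Claim (chars (arr σ 2)) w) → Explored 0 σ τ
    unchanged c inc absurd = record
      { incumbent = Incumbent-core c inc
      ; current   = cong chars arr2
      ; counters  = λ j _ → cong (λ A → A j) arr4
      ; improved  = ≤-reflexive (sym reg1)
      ; optimal   = λ { {w = w} done claim → contradiction claim (absurd {w}) }
      }
      where open SameCore c

  module SparseTest {𝒮 : GraphClass ℓ} {T₁ : ℕ → ℕ} {R : Program} (recognises : Recognises R 𝒮 T₁)
                    (T₁≤T : ∀ (U : VertexSet G) → T₁ ∣ U ∣ ≤ T) (B : VertexSet G) where

    Sparse : VertexSet G → Set ℓ
    Sparse U = 𝒮 (G [ U ])

    SparseOfSize : VertexSet G → ℕ → Set ℓ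
    SparseOfSize X w = Sparse X × w ≡ ∣ X ∣

    open Enumeration Sparse B SparseOfSize

    test-runs : ∀ {σ} → Incumbent Sparse B σ → Runs 162 (test R) σ (Explored 0 σ)
    test-runs {σ} inc =
      seq-rule (members-runs 2 refl 0≡n) λ {τ₁} f₁ mem →
      seq-rule (fill-runs (Input-cong (keepReg f₁ 0 refl) (keepArr f₁ 0 refl) input) mem) λ {τ₂} f₂ input′ →
      seq-rule (shift-runs (T₁≤T X) (recognises _ _ input′)) λ {τ₃} f₃ answer →
      let core = core-trans (core-frame refl (frame-⨾ f₁ f₂)) (shift-core R f₃)
          open SameCore core
          9≡size = trans (keepReg f₃ 9 (shift-keepsReg R (≤ᵇ⇒≤ 10 16 _)))
                         (trans (keepReg f₂ 9 refl) (Members.size mem))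
      in if-rule (≤ᵇ⇒≤ 1 63 _)
        (λ accepted → weaken ≤-refl
          (λ imp → explored core imp λ { (_ , refl) →
             ≤-trans (≤-reflexive (sym 9≡size)) (Improved.candidate imp) })
          (improve-runs 2 refl (Incumbent-core core inc)
            (subst Sparse (cong chars (sym arr2)) (sparse answer accepted))
            (trans 9≡size (cong (∣_∣ ∘ chars {n}) (sym arr2)))))
        (λ rejected → weaken (m≤n+m 6 37) id (straight ⇓skip
          (unchanged core inc λ { (X∈𝒮 , _) → dense answer rejected X∈𝒮 })))
      where
      open Incumbent inc
      X = chars {n} (arr σ 2)
      sparse : ∀ {k} → (k ≡ 1 × Sparse X) ⊎ (k ≡ 0 × ¬ Sparse X) → k ≢ 0 → Sparse X
      sparse (inj₁ (_ , X∈𝒮)) _   = X∈𝒮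
      sparse (inj₂ (k≡0 , _)) k≢0 = contradiction k≡0 k≢0
      dense : ∀ {k} → (k ≡ 1 × Sparse X) ⊎ (k ≡ 0 × ¬ Sparse X) → k ≡ 0 → ¬ Sparse X
      dense (inj₁ (refl , _)) ()
      dense (inj₂ (_ , X∉𝒮))  _ = X∉𝒮

  module Extension {𝒮 : GraphClass ℓ} {T₂ : ℕ → ℕ} {M : Program} (finds : FindsMaximumIndependentSet M 𝒮 T₂)
                   (T₂≤T : ∀ (U : VertexSet G) → T₂ ∣ U ∣ ≤ T) (hereditary : Hereditary 𝒮)
                   {B : VertexSet G} (B∈𝒮 : 𝒮 (G [ B ])) where

    -- Every independent `W` makes such a claim, at `X = W ∩ ∁ B`.
    Extends : VertexSet G → ℕ → Set
    Extends X w = ∃[ W ] Independent G W × W ∩ ∁ B ≡ X × w ≡ ∣ W ∣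

    open Enumeration (Independent G) B Extends

    char-at : ∀ {U : VertexSet G} σ τ a v → arr τ a ≡ arr σ a → chars (arr σ a) ≡ U → reg τ 8 ≡ toℕ v →
              nonzero (arr τ a (reg τ 8)) ≡ lookup U v
    char-at σ τ a v a≡ U≡ 8≡v = trans (cong₂ (λ A i → nonzero (A i)) a≡ 8≡v)
      (trans (sym (lookup-chars (arr σ a) v)) (cong (λ U → lookup U v) U≡))

    record Extended (X : VertexSet G) (σ τ : State) : Set where
      field
        core    : SameCore σ τ
        Y       : VertexSet G
        free    : Free G B X Y
        I       : Subset ∣ Y ∣
        maximum : MaximumIndependent (G [ Y ]) I
        result  : chars (arr τ 13) ≡ X ∪ lift Y I

    extend-runs : ∀ {σ} → Incumbent (Independent G) B σ → Runs 245 (extend M) σ (Extended (chars (arr σ 2)) σ)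
    extend-runs {σ} inc =
      seq-rule (neighbours-runs 2 refl input) λ {τ₁} f₁ nbr →
      let C = chars {n} (arr τ₁ 11)
          Y = B ∩ ∁ (X ∪ C)
      in
      seq-rule (pointwise-runs 12 unreached Y (trans (keepReg f₁ 0 refl) 0≡n)
        (λ v {τ} g 8≡v → unreached-value {τ₁} v f₁ g 8≡v)) λ {τ₂} f₂ Y≡ →
      seq-rule (members-runs 12 refl (trans (keepReg (frame-⨾ f₁ f₂) 0 refl) 0≡n)) λ {τ₃} f₃ mem →
      let f₁₃ = frame-⨾ f₁ (frame-⨾ f₂ f₃)
          mem = subst (λ U → Members U τ₃) Y≡ mem
      in
      seq-rule (fill-runs (Input-cong (keepReg f₁₃ 0 refl) (keepArr f₁₃ 0 refl) input) mem) λ {τ₄} f₄ input′ →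
      -- `Y` lies in `B`, so heredity licenses the call of `M`, which promises nothing outside `𝒮`.
      seq-rule (shift-runs (T₂≤T Y) (finds (G [ Y ]) (hereditary-⊆ hereditary G (p∩q⊆p B _) B∈𝒮) _ input′))
        λ {τ₅} f₅ maximum →
      let core = core-trans (core-frame refl (frame-⨾ f₁₃ f₄)) (shift-core M f₅)
          kept : ∀ a → keepsArr a fill ≡ true → {_ : IsTrue (a <ᵇ 16)} → arr τ₅ a ≡ arr τ₃ a
          kept a k {a<16} = trans (keepArr f₅ a (shift-keepsArr M (<ᵇ⇒< a 16 a<16))) (keepArr f₄ a k)
          I = chars {∣ Y ∣} (arr τ₅ 16)
      in
      weaken ≤-refl (λ { (f₆ , result) → record
        { core = core-trans core (core-frame refl f₆)
        ; Y = Y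
        ; free = free nbr
        ; I = I
        ; maximum = maximum
        ; result = result } })
      (framed (pointwise-runs 13 joined (X ∪ lift Y I) (trans (SameCore.reg0 core) 0≡n) λ v {τ} g 8≡v →
        let at : ∀ a U → keepsArr a (pointwise 13 joined) ≡ true → chars (arr τ₅ a) ≡ U →
                 nonzero (arr τ a (reg τ 8)) ≡ lookup U v
            at a U k U≡ = char-at τ₅ τ a v (keepArr g a k) U≡ 8≡v
            r≡ : arr τ 10 (reg τ 8) ≡ rank Y (toℕ v)
            r≡ = trans (cong₂ (λ A i → A i) (trans (keepArr g 10 refl) (kept 10 refl)) 8≡v)
                       (Members.ranks mem v)
        in joined-value {Y} (arr τ₅ 16) (arr τ 2 (reg τ 8))
                          (arr τ 12 (reg τ 8)) (arr τ 16 (arr τ 10 (reg τ 8))) v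
                          (at 2 X refl (cong chars (SameCore.arr2 core)))
                          (at 12 Y refl (trans (cong chars (trans (kept 12 refl) (keepArr f₃ 12 refl))) Y≡))
                          (cong₂ (λ A i → nonzero (A i)) (keepArr g 16 refl) r≡)))
      where
      open Incumbent inc
      X = chars {n} (arr σ 2)
      free : ∀ {C} → Neighbourhood G X C → Free G B X (B ∩ ∁ (X ∪ C))
      free {C} nbr = record
        { ⊆B          = p∩q⊆p B _
        ; avoids      = λ v∈Y v∈X → unreached-by v∈Y (x∈p∪q⁺ (inj₁ v∈X))
        ; nonadjacent = λ v∈Y → Neighbourhood.sound nbr (∉⇒lookup≡false λ v∈C →
                          unreached-by v∈Y (x∈p∪q⁺ (inj₂ v∈C)))
        ; complete    = λ {v} v∈B v∉X nonadj → x∈p∩q⁺ (v∈B , x∉p⇒x∈∁p λ v∈X∪C → Data.Sum.[ v∉X ,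
                          lookup≡false⇒∉ (Neighbourhood.complete nbr nonadj) ] (x∈p∪q⁻ X C v∈X∪C))
        }
        where
        unreached-by : ∀ {v} → v ∈ B ∩ ∁ (X ∪ C) → v ∉ X ∪ C
        unreached-by v∈ = x∈∁p⇒x∉p (p∩q⊆q B (∁ (X ∪ C)) v∈)
      unreached-value : ∀ {τ₁ τ} v → Frame (neighbours 2) σ τ₁ → Frame (pointwise 12 unreached) τ₁ τ →
        reg τ 8 ≡ toℕ v → nonzero (⟦ unreached ⟧ τ) ≡ lookup (B ∩ ∁ (X ∪ chars (arr τ₁ 11))) v
      unreached-value {τ₁} {τ} v f g 8≡v = begin
        nonzero (1 ∸ ((1 ∸ b) + (1 ∸ (1 ∸ (x + c)))))  ≡⟨ nonzero-and b (1 ∸ (x + c)) ⟩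
        nonzero b ∧ nonzero (1 ∸ (x + c))
          ≡⟨ cong (nonzero b ∧_) (trans (nonzero-not (x + c)) (cong not (nonzero-+ x c))) ⟩
        nonzero b ∧ not (nonzero x ∨ nonzero c)
          ≡⟨ cong₂ (λ p q → p ∧ not q)
                   (char-at σ τ 3 v (trans (keepArr g 3 refl) (keepArr f 3 refl)) base 8≡v)
                   (cong₂ _∨_ (char-at σ τ 2 v (trans (keepArr g 2 refl) (keepArr f 2 refl)) refl 8≡v)
                              (char-at τ₁ τ 11 v (keepArr g 11 refl) refl 8≡v)) ⟩
        lookup B v ∧ not (lookup X v ∨ lookup C v)
          ≡⟨ cong (λ q → lookup B v ∧ not q) (lookup-zipWith _∨_ v X C) ⟨
        lookup B v ∧ not (lookup (X ∪ C) v)            ≡⟨ cong (lookup B v ∧_) (lookup-map v not (X ∪ C)) ⟨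
        lookup B v ∧ lookup (∁ (X ∪ C)) v              ≡⟨ lookup-zipWith _∧_ v B (∁ (X ∪ C)) ⟨
        lookup (B ∩ ∁ (X ∪ C)) v                       ∎
        where
        open ≡-Reasoning
        C = chars {n} (arr τ₁ 11)
        b = arr τ 3 (reg τ 8)
        x = arr τ 2 (reg τ 8)
        c = arr τ 11 (reg τ 8)
      joined-value : ∀ {Y} f x y z v → nonzero x ≡ lookup X v → nonzero y ≡ lookup Y v →
        nonzero z ≡ nonzero (f (rank Y (toℕ v))) →
        nonzero (x + (1 ∸ ((1 ∸ y) + (1 ∸ z)))) ≡ lookup (X ∪ lift Y (chars f)) v
      joined-value {Y} f x y z v x≡ y≡ z≡ = begin
        nonzero (x + (1 ∸ ((1 ∸ y) + (1 ∸ z))))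
          ≡⟨ trans (nonzero-+ x _) (cong (nonzero x ∨_) (nonzero-and y z)) ⟩
        nonzero x ∨ nonzero y ∧ nonzero z
          ≡⟨ cong₂ _∨_ x≡ (cong₂ _∧_ y≡ z≡) ⟩
        lookup X v ∨ lookup Y v ∧ nonzero (f (rank Y (toℕ v)))
          ≡⟨ cong (lookup X v ∨_) (lookup-lift Y (nonzero ∘ f) v) ⟨
        lookup X v ∨ lookup (lift Y (chars f)) v
          ≡⟨ lookup-zipWith _∨_ v X (lift Y (chars f)) ⟨
        lookup (X ∪ lift Y (chars f)) v ∎
        where open ≡-Reasoning

    independent-if-conflict-free : ∀ {W C} → Neighbourhood G W C → ∣ W ∩ C ∣ ≡ 0 → Independent G W
    independent-if-conflict-free {W} {C} nbr none u∈ v∈ =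
      Neighbourhood.sound nbr (∉⇒lookup≡false λ u∈C → ∈⇒∣p∣≢0 (x∈p∩q⁺ (u∈ , u∈C)) none) v∈

    conflict-free-if-independent : ∀ {W C} → Neighbourhood G W C → Independent G W → ∣ W ∩ C ∣ ≡ 0
    conflict-free-if-independent {W} {C} nbr ind = empty⇒∣p∣≡0 λ { (v , v∈) →
      let v∈W , v∈C = x∈p∩q⁻ W C v∈ in
      lookup≡false⇒∉ (Neighbourhood.complete nbr (λ u∈ → ind v∈W u∈)) v∈C }

    extends : ∀ {X Y I W} → Free G B X Y → MaximumIndependent (G [ Y ]) I → Independent G W → W ∩ ∁ B ≡ X →
              Independent G (X ∪ lift Y I) × ∣ W ∣ ≤ ∣ X ∪ lift Y I ∣
    extends free maximum ind refl = extension-independent G free ind maximum , extension-size G free ind maximum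

    record-runs : ∀ {σ₀ σ} → Incumbent (Independent G) B σ₀ → Extended (chars (arr σ₀ 2)) σ₀ σ →
                  Runs 242 keepIfIndependent σ (Explored 0 σ₀)
    record-runs {σ₀} {σ} inc₀ ext =
      seq-rule (neighbours-runs 13 refl input) λ {τ₁} f₁ nbr →
      let nbr = subst (λ U → Neighbourhood G U (chars (arr τ₁ 11))) result nbr
          Z = W ∩ chars (arr τ₁ 11)
      in
      seq-rule (pointwise-runs 14 conflict Z (trans (keepReg f₁ 0 refl) 0≡n) λ v {τ} g 8≡v →
        trans (nonzero-and (arr τ 13 (reg τ 8)) (arr τ 11 (reg τ 8)))
        (trans (cong₂ _∧_ (char-at σ τ 13 v (trans (keepArr g 13 refl) (keepArr f₁ 13 refl)) result 8≡v)
                          (char-at τ₁ τ 11 v (keepArr g 11 refl) refl 8≡v))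
               (sym (lookup-zipWith _∧_ v W _)))) λ {τ₂} f₂ Z≡ →
      seq-rule (members-runs 14 refl (trans (keepReg (frame-⨾ f₁ f₂) 0 refl) 0≡n)) λ {τ₃} f₃ mem →
      let f₁₃ = frame-⨾ f₁ (frame-⨾ f₂ f₃)
          core₃ = core-trans core (core-frame refl f₁₃)
          9≡Z = trans (Members.size mem) (cong ∣_∣ Z≡)
          W≡ = trans (cong chars (keepArr f₁₃ 13 refl)) result
      in if-rule (≤ᵇ⇒≤ 1 63 _)
        -- A conflict refutes every claim: if `X` were the part outside `B` of an independent set,
        -- the union would be independent.
        (λ 9≢0 → weaken (m≤n+m 6 81) id (straight ⇓skip (unchanged core₃ inc₀
          λ { (_ , ind , X≡ , _) → 9≢0 (trans 9≡Z
                (conflict-free-if-independent nbr (proj₁ (extends free maximum ind X≡)))) })))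
        (λ 9≡0 → seq-rule (members-runs 13 refl (trans (SameCore.reg0 core₃) (Incumbent.0≡n inc₀)))
          λ {τ₄} f₄ mem′ →
          let core₄ = core-trans core₃ (core-frame refl f₄)
              W≡′ = trans (cong chars (keepArr f₄ 13 refl)) W≡
              9≡W = trans (Members.size mem′) (cong ∣_∣ W≡)
          in weaken ≤-refl
            (λ imp → explored core₄ imp λ { (_ , ind , X≡ , refl) →
              ≤-trans (proj₂ (extends free maximum ind X≡))
                      (≤-trans (≤-reflexive (sym 9≡W)) (Improved.candidate imp)) })
            (improve-runs 13 refl (Incumbent-core core₄ inc₀)
              (subst (Independent G) (sym W≡′)
                (independent-if-conflict-free nbr (trans (sym 9≡Z) 9≡0)))
              (trans 9≡W (cong ∣_∣ (sym W≡′)))))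
      where
      open Extended ext
      inc = Incumbent-core core inc₀
      open Incumbent inc
      W : VertexSet G
      W = chars (arr σ₀ 2) ∪ lift Y I

    try-runs : ∀ {σ} → Incumbent (Independent G) B σ →
               Runs 488 (extend M ⨾ keepIfIndependent) σ (Explored 0 σ)
    try-runs inc = seq-rule (extend-runs inc) λ _ ext → record-runs inc ext

-- The algorithm

module Correctness
  {ℓ₁ ℓ₂ : Level} {𝒮 : GraphClass ℓ₁} {𝒟 : GraphClass ℓ₂} (classes : SparseDenseClasses 𝒮 𝒟)
  {t : ℕ} (co-Kₜ-free : ∀ {H} → 𝒟 H → CoKFree t H) {T₁ T₂ : ℕ → ℕ} {R M : Program}
  (recognises : Recognises R 𝒮 T₁) (finds : FindsMaximumIndependentSet M 𝒮 T₂)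
  {G : Graph} (partition : SparseDensePartition 𝒮 𝒟 G) {T : ℕ} (1≤T : 1 ≤ T)
  (T₁≤T : ∀ (U : VertexSet G) → T₁ ∣ U ∣ ≤ T) (T₂≤T : ∀ (U : VertexSet G) → T₂ ∣ U ∣ ≤ T) where

  open SparseDenseClasses classes
  open SparseDensePartition partition
  open Partition classes partition
  open Phases G T 1≤T

  Sparse : VertexSet G → Set ℓ₁
  Sparse U = 𝒮 (G [ U ])

  rounds : Program
  rounds = copy 1 2 ⨾ enumerate (test R) (suc (c + c))

  rounds-keepReg : ∀ {x} → x < 16 → keepsReg x (test skip) ≡ true → keepsReg x (copy 1 2) ≡ true →
                   keepsReg x rounds ≡ true
  rounds-keepReg {x} x<16 kept kept′ = cong₂ _∧_ kept′
    (enumerate-keepsReg {x} {test R} (suc (c + c)) (test-keepsReg R x<16 kept))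

  -- Invariant: after `i` rounds the best set has at least `∣ S ∣` or at least `i` vertices. Either
  -- way `n` rounds are enough, as `∣ S ∣ ≤ n`.
  local-search-runs : ∀ {B σ} → Incumbent Sparse B σ →
    Runs (23 + suc (29 + (suc (c + c) * 14 + 168))) (for 2 0 rounds) σ
         (λ τ → Incumbent Sparse B τ × ∣ S ∣ ≤ reg τ 1)
  local-search-runs {B} {σ} inc = weaken ≤-refl finish
    (for-rule I n n≤N (Incumbent.0≡n inc)
      (rounds-keepReg (≤ᵇ⇒≤ 3 16 _) refl refl)
      (trans (∧-identityʳ _) (rounds-keepReg (≤ᵇ⇒≤ 1 16 _) refl refl))
      (Incumbent-cong refl refl refl refl refl inc , inj₂ z≤n)
      λ i τ _ _ (inc , progress) →
        seq-rule (copy-runs 1 2 refl (Incumbent.0≡n inc)) λ f copied →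
        weaken ≤-refl (next i τ inc progress f copied)
          (enumerate-runs test-runs (suc (c + c))
            (Incumbent-cong (keepReg f 0 refl) (keepReg f 1 refl) (keepArr f 0 refl)
                            (keepArr f 1 refl) (keepArr f 3 refl) inc)))
    where
    open SparseTest {𝒮 = 𝒮} {T₁} {R} recognises T₁≤T B using (SparseOfSize; test-runs)
    open Enumeration Sparse B SparseOfSize
    I : ℕ → State → Set ℓ₁
    I i τ = Incumbent Sparse B τ × (∣ S ∣ ≤ reg τ 1 ⊎ i ≤ reg τ 1)
    finish : ∀ {τ} → I n τ → Incumbent Sparse B τ × ∣ S ∣ ≤ reg τ 1
    finish (inc , inj₁ S≤) = inc , S≤
    finish (inc , inj₂ n≤) = inc , ≤-trans (∣p∣≤n S) n≤
    next : ∀ i τ → Incumbent Sparse B τ → (∣ S ∣ ≤ reg τ 1 ⊎ toℕ i ≤ reg τ 1) →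
           ∀ {τ₁} → Frame (copy 1 2) τ τ₁ → chars {n} (arr τ₁ 2) ≡ chars (arr τ 1) →
           ∀ {τ₂} → Explored (suc (c + c)) τ₁ τ₂ → I (suc (toℕ i)) (setReg 2 (suc (toℕ i)) τ₂)
    next i τ inc progress {τ₁} f copied {τ₂} ex =
      Incumbent-cong refl refl refl refl refl incumbent , progress′ progress
      where
      open Explored ex
      mono : reg τ 1 ≤ reg τ₂ 1
      mono = ≤-trans (≤-reflexive (sym (keepReg f 1 refl))) improved
      progress′ : ∣ S ∣ ≤ reg τ 1 ⊎ toℕ i ≤ reg τ 1 → ∣ S ∣ ≤ reg τ₂ 1 ⊎ suc (toℕ i) ≤ reg τ₂ 1
      progress′ (inj₁ S≤) = inj₁ (≤-trans S≤ mono)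
      progress′ (inj₂ i≤) with ∣ S ∣ ≤? reg τ 1
      ... | yes S≤ = inj₁ (≤-trans S≤ mono)
      -- Below `∣ S ∣`, some sparse `Y` within the flips of this round is larger than the set that
      -- the round began with.
      ... | no S≰ with improvement (chars {n} (arr τ 1)) S (sparse-outside-S _ (Incumbent.good inc))
                                   (subst (_< ∣ S ∣) (Incumbent.size inc) (≰⇒> S≰))
      ...   | Y , Y⊆S , B<Y , flips = inj₂ (begin
        suc (toℕ i)                ≤⟨ s≤s i≤ ⟩
        suc (reg τ 1)              ≡⟨ cong suc (Incumbent.size inc) ⟩
        suc ∣ chars {n} (arr τ 1) ∣  ≤⟨ B<Y ⟩
        ∣ Y ∣                      ≤⟨ optimal (subst (λ U → Flips _ U Y) (sym copied) flips)
                                              (hereditary-⊆ sparse-hereditary G Y⊆S sparse , refl) ⟩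
        reg τ₂ 1                   ∎)
        where open ≤-Reasoning

  independent-search-runs : ∀ {B σ} → Sparse B → ∣ S ∣ ≤ ∣ B ∣ → Incumbent (Independent G) B σ →
    chars (arr σ 2) ≡ ⊥ →
    Runs ((t + c) * 14 + 494) (enumerate (extend M ⨾ keepIfIndependent) (t + c)) σ
         (λ τ → reg τ 0 ≡ n × MaximumIndependent G (chars (arr τ 1)))
  independent-search-runs {B} {σ} B∈𝒮 S≤B inc empty = weaken ≤-refl finish (enumerate-runs try-runs (t + c) inc)
    where
    open Extension {𝒮 = 𝒮} {T₂} {M} finds T₂≤T sparse-hereditary {B} B∈𝒮 using (Extends; try-runs)
    open Enumeration (Independent G) B Extends
    finish : ∀ {τ} → Explored (t + c) σ τ → reg τ 0 ≡ n × MaximumIndependent G (chars (arr τ 1))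
    finish ex = Incumbent.0≡n incumbent , Incumbent.good incumbent , λ W ind →
      -- `W ∩ ∁ B` is reached from the empty set by one flip per member.
      ≤-trans (optimal (subst (λ U → Flips (t + c) U (W ∩ ∁ B)) (sym empty)
                         (flips-mono (independent-outside-large co-Kₜ-free B B∈𝒮 S≤B W ind) (flips-from-⊥ _)))
                       (W , ind , refl , refl))
              (≤-reflexive (Incumbent.size incumbent))
      where open Explored ex

  empty-incumbent : ∀ {ℓ} {Good : VertexSet G → Set ℓ} {B σ} → Input G σ → chars (arr σ 3) ≡ B →
    chars (arr σ 1) ≡ ⊥ → reg σ 1 ≡ 0 → Good ⊥ → Incumbent Good B σ
  empty-incumbent {Good = Good} input base empty 1≡0 good = record
    { input = input
    ; base  = base
    ; good  = subst Good (sym empty) good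
    ; size  = trans 1≡0 (sym (trans (cong ∣_∣ empty) (∣⊥∣≡0 n)))
    }

  -- The `2c + 1` and `t + c` levels of enumeration, at 14 each, account for `42 * c + 14 * t`, up
  -- to a constant.
  search-runs : ∀ {σ} → Input G σ → Runs (894 + 42 * c + 14 * t) (search (suc (c + c)) (t + c) R M) σ
    (λ τ → MaximumIndependent G (outputSet n τ))
  search-runs {σ} input = weaken (≤-reflexive (exponent c t)) id (
    seq-rule (clear-runs 1 (Input.size input)) λ {τ₁} f₁ cleared →
    seq-rule assign λ { f₂ refl →
    seq-rule (local-search-runs (empty-incumbent
        (Input-cong (keepReg (frame-⨾ f₁ f₂) 0 refl) (keepArr (frame-⨾ f₁ f₂) 0 refl) input)
        -- The search may start from the empty set, which is sparse as a subset of `S`.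
        refl cleared refl (hereditary-⊆ sparse-hereditary G {S} (⊥⊆) sparse)))
      λ {τ₃} _ (inc , S≤) →
    let open Incumbent inc
        B = chars {n} (arr τ₃ 1)
        S≤B = ≤-trans S≤ (≤-reflexive size)
    in
    seq-rule (copy-runs 1 3 refl 0≡n) λ {τ₄} f₄ copied →
    seq-rule (clear-runs 1 (trans (keepReg f₄ 0 refl) 0≡n)) λ {τ₅} f₅ cleared₁ →
    seq-rule assign λ { f₆ refl →
    seq-rule (clear-runs 2 (trans (keepReg (frame-⨾ f₄ (frame-⨾ f₅ f₆)) 0 refl) 0≡n)) λ {τ₇} f₇ cleared₂ →
    let f₄₇ = frame-⨾ f₄ (frame-⨾ f₅ (frame-⨾ f₆ f₇))
        f₅₇ = frame-⨾ f₅ (frame-⨾ f₆ f₇)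
    in
    seq-rule (independent-search-runs {B} good S≤B
        (empty-incumbent (Input-cong (keepReg f₄₇ 0 refl) (keepArr f₄₇ 0 refl) (Incumbent.input inc))
          (trans (cong chars (keepArr f₅₇ 3 refl)) copied)
          (trans (cong chars (keepArr f₇ 1 refl)) cleared₁)
          (keepReg f₇ 1 refl)
          (λ u∈⊥ → contradiction u∈⊥ ∉⊥))
        cleared₂)
      λ _ (0≡n , maximum) →
    weaken ≤-refl (λ eq → subst (MaximumIndependent G) (sym eq) maximum) (copy-runs 1 0 refl 0≡n) } })
    where
    exponent : ∀ c t →
      30 + (7 + suc (23 + suc (29 + (suc (c + c) * 14 + 168)) +
        (30 + (30 + (7 + (30 + suc ((t + c) * 14 + 494 + 29))))))) ≡ 894 + 42 * c + 14 * t
    exponent = solve-∀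

  -- For positive `t` the part of the exponent without `t` is at most its product with `t`, so the
  -- exponent becomes a multiple of `t`.
  search-halts : 1 ≤ t → ∀ {σ} → Input G σ →
    HaltsWithin (search (suc (c + c)) (t + c) R M) σ (T * N ^ ((894 + 42 * c + 14) * t))
                (λ τ → MaximumIndependent G (outputSet n τ))
  search-halts 1≤t input = within (≤-trans
    (+-monoˡ-≤ (14 * t) (m≤m*n′ (894 + 42 * c)))
    (≤-reflexive (sym (*-distribʳ-+ t (894 + 42 * c) 14)))) (search-runs input)
    where
    m≤m*n′ : ∀ m → m ≤ m * t
    m≤m*n′ m = subst (_≤ m * t) (*-identityʳ m) (*-monoʳ-≤ m 1≤t)

theorem7 : ∀ {ℓ₁ ℓ₂ : Level} (𝒮 : GraphClass ℓ₁) (𝒟 : GraphClass ℓ₂) →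
    SparseDenseClasses 𝒮 𝒟 →
    ∃[ a ] ((t : ℕ) (T₁ T₂ : ℕ → ℕ) →
    T₁ Preserves _≤_ ⟶ _≤_ →
    T₂ Preserves _≤_ ⟶ _≤_ →
    𝒟 ⊆ CoKFree t →
    (∃[ R ] Recognises R 𝒮 T₁) →
    (∃[ M ] FindsMaximumIndependentSet M 𝒮 T₂) →
    ∃[ P ] FindsMaximumIndependentSet P (SparseDense 𝒮 𝒟)
    (λ n → (T₁ n + T₂ n) * (2 ⊔ n) ^ (a * t)))
theorem7 𝒮 𝒟 classes = 894 + 42 * c + 14 , algorithm
  where
  open SparseDenseClasses classes
  algorithm : (t : ℕ) (T₁ T₂ : ℕ → ℕ) → T₁ Preserves _≤_ ⟶ _≤_ → T₂ Preserves _≤_ ⟶ _≤_ →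
    𝒟 ⊆ CoKFree t → (∃[ R ] Recognises R 𝒮 T₁) → (∃[ M ] FindsMaximumIndependentSet M 𝒮 T₂) →
    ∃[ P ] FindsMaximumIndependentSet P (SparseDense 𝒮 𝒟)
      (λ n → (T₁ n + T₂ n) * (2 ⊔ n) ^ ((894 + 42 * c + 14) * t))
  -- No graph is co-K₀-free, since ∅ is independent, so there is no input for t = 0.
  algorithm zero T₁ T₂ _ _ co-K₀-free _ _ = skip , λ G partition _ _ →
    let open SparseDensePartition partition in
    contradiction (∣⊥∣≡0 ∣ D ∣) (co-K₀-free dense (⊥ {∣ D ∣}) λ u∈⊥ → contradiction u∈⊥ ∉⊥)
  algorithm (suc t) T₁ T₂ mono₁ mono₂ co-Kₜ-free (R , recognises) (M , finds) =
    search (suc (c + c)) (suc t + c) R M , λ G partition σ input →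
      let n = order G
          -- A run on `G` itself, considered only to learn that `T₁ n` is positive.
          _ , _ , run , k≤T₁ , _ = recognises G σ input
      in Correctness.search-halts classes co-Kₜ-free recognises finds partition {T₁ n + T₂ n}
           (≤-trans (1≤steps run) (≤-trans k≤T₁ (m≤m+n (T₁ n) (T₂ n))))
           -- The given programs are called on induced subgraphs; monotonicity charges each call as
           -- if on `n` vertices.
           (λ U → ≤-trans (mono₁ (∣p∣≤n U)) (m≤m+n (T₁ n) (T₂ n)))
           (λ U → ≤-trans (mono₂ (∣p∣≤n U)) (m≤n+m (T₂ n) (T₁ n)))
           (s≤s z≤n) input
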